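{- Given a directed acyclic graph $G$ with $n$ vertices and $m$ arcs, and $k$ pairs of vertices of $G$, all lowest common ancestors of all the $k$ given pairs can be found in time $O(n^{\omega} + n(m+k) + n^2 k)$, where $O(n^{\omega})$ is the time needed to compute the transitive closure of $G$.
   Context: All paths are directed, and a single vertex counts as a (trivial) directed path. For distinct vertices $u,v$ of a directed acyclic graph $G$, a vertex $s\in G$ is a junction of $u,v$ if there are internally disjoint directed paths $P$ from $s$ to $u$ and $Q$ from $s$ to $v$ in $G$, where internally disjoint means that $s$ is the only vertex common to $P$ and $Q$. In particular, if $u$ is a proper ancestor of $v$, then $u$ is a junction of $u,v$. By convention no vertex is a junction of a pair $u,u$. A vertex $s$ is a lowest common ancestor (LCA) of $u,v$, $u\neq v$, if $s$ is a junction of $u,v$ and for every junction $s'\neq s$ of $u,v$ there is no directed path in $G$ from $s$ to $s'$. A pair may have several LCAs. Here $\omega<2.376$ is the exponent of fast Boolean matrix multiplication. -}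

module Defs where

open import Data.Bool.Base using (if_then_else_; _∧_)
open import Data.Empty using (⊥)
open import Data.Fin.Base using (Fin; toℕ)
open import Data.Integer.Base using (+_)
open import Data.List.Base using (List; []; _∷_; length; lookup; map)
open import Data.List.Membership.Propositional using (_∈_)
open import Data.List.Relation.Unary.Unique.Propositional using (Unique)
open import Data.Nat.Base using (ℕ; zero; suc; _+_; _*_; _∸_; _≤_; _≡ᵇ_; _<ᵇ_; NonZero) renaming (_^_ to _**_)
open import Data.Product.Base using (_×_; _,_; proj₁; proj₂; Σ-syntax; ∃-syntax)
open import Data.Rational.Base using (ℚ; _/_) renaming (_<_ to _<ℚ_)
open import Data.Sum.Base using (_⊎_)
open import Function.Bundles using (_⇔_)
open import Relation.Binary.Construct.Closure.ReflexiveTransitive using (Star; ε; _◅_)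
open import Relation.Binary.Construct.Closure.Transitive using (TransClosure)
open import Relation.Binary.PropositionalEquality using (_≡_; _≢_)
open import Relation.Nullary.Negation using (¬_)

-- Finite and simple (no parallel arcs; loops are excluded by acyclicity).
-- The order of `arcs` is arbitrary.
record DAG : Set where
  field
    n       : ℕ
    arcs    : List (Fin n × Fin n)

  Vertex : Set
  Vertex = Fin n

  Arc : Vertex → Vertex → Set
  Arc u v = (u , v) ∈ arcs

  field
    simple  : Unique arcs
    acyclic : ∀ u → ¬ TransClosure Arc u u

  m : ℕ
  m = length arcs

  -- Includes the trivial path.  A walk in an acyclic graph never repeats a
  -- vertex, so walks are paths.
  Path : Vertex → Vertex → Set
  Path = Star Arc

  vertices : ∀ {u v} → Path u v → List Vertex
  vertices {u} ε       = u ∷ []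
  vertices {u} (_ ◅ p) = u ∷ vertices p

  InternallyDisjoint : ∀ {s u v} → Path s u → Path s v → Set
  InternallyDisjoint {s} P Q = ∀ x → x ∈ vertices P → x ∈ vertices Q → x ≡ s

  -- The conjunct u ≢ v is the convention that a pair u,u has no junctions.
  IsJunction : Vertex → Vertex → Vertex → Set
  IsJunction s u v =
    u ≢ v × (Σ[ P ∈ Path s u ] Σ[ Q ∈ Path s v ] InternallyDisjoint P Q)

  IsLCA : Vertex → Vertex → Vertex → Set
  IsLCA s u v =
    IsJunction s u v × (∀ s′ → IsJunction s′ u v → s′ ≢ s → ¬ Path s s′)

-- Word RAM: a fixed program over finitely many arrays of machine words.
-- A register is cell 0 of an array.
Name : Set
Name = ℕ

Store : Set
Store = Name → ℕ → ℕ

data Expr : Set where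
  lit             : ℕ → Expr
  _[_]            : Name → Expr → Expr
  _⊕_ _⊖_ _⊗_ _≺_ : Expr → Expr → Expr

data Cmd : Set where
  skip    : Cmd
  _[_]≔_  : Name → Expr → Expr → Cmd
  _⨟_     : Cmd → Cmd → Cmd
  ifte    : Expr → Cmd → Cmd → Cmd
  while   : Expr → Cmd → Cmd

eval : Store → Expr → ℕ
eval σ (lit c)   = c
eval σ (a [ e ]) = σ a (eval σ e)
eval σ (e ⊕ f)   = eval σ e + eval σ f
eval σ (e ⊖ f)   = eval σ e ∸ eval σ f
eval σ (e ⊗ f)   = eval σ e * eval σ f
eval σ (e ≺ f)   = if eval σ e <ᵇ eval σ f then 1 else 0

cost : Expr → ℕ
cost (lit c)   = 1
cost (a [ e ]) = 1 + cost e
cost (e ⊕ f)   = 1 + cost e + cost f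
cost (e ⊖ f)   = 1 + cost e + cost f
cost (e ⊗ f)   = 1 + cost e + cost f
cost (e ≺ f)   = 1 + cost e + cost f

update : Store → Name → ℕ → ℕ → Store
update σ a i v b j = if (a ≡ᵇ b) ∧ (i ≡ᵇ j) then v else σ b j

-- W ⊢ c , σ ⇓ σ′ , t : on a machine whose words hold the values 0 … W, the
-- program c started in σ halts in σ′ after t unit-cost operations.  Storing a
-- value above W is not possible, so unit-cost arithmetic cannot be abused by
-- packing data into huge numbers.
data _⊢_,_⇓_,_ (W : ℕ) : Cmd → Store → Store → ℕ → Set where
  skip : ∀ {σ} → W ⊢ skip , σ ⇓ σ , 1
  assign : ∀ {σ a i e} → eval σ e ≤ W →
    W ⊢ a [ i ]≔ e , σ ⇓ update σ a (eval σ i) (eval σ e) , (1 + cost i + cost e)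
  seq : ∀ {σ σ₁ σ₂ c d t₁ t₂} →
    W ⊢ c , σ ⇓ σ₁ , t₁ → W ⊢ d , σ₁ ⇓ σ₂ , t₂ →
    W ⊢ c ⨟ d , σ ⇓ σ₂ , (t₁ + t₂)
  if-true : ∀ {σ σ₁ e c d t} → eval σ e ≢ 0 → W ⊢ c , σ ⇓ σ₁ , t →
    W ⊢ ifte e c d , σ ⇓ σ₁ , (1 + cost e + t)
  if-false : ∀ {σ σ₁ e c d t} → eval σ e ≡ 0 → W ⊢ d , σ ⇓ σ₁ , t →
    W ⊢ ifte e c d , σ ⇓ σ₁ , (1 + cost e + t)
  while-true : ∀ {σ σ₁ σ₂ e c t₁ t₂} → eval σ e ≢ 0 →
    W ⊢ c , σ ⇓ σ₁ , t₁ → W ⊢ while e c , σ₁ ⇓ σ₂ , t₂ →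
    W ⊢ while e c , σ ⇓ σ₂ , (1 + cost e + t₁ + t₂)
  while-false : ∀ {σ e c} → eval σ e ≡ 0 →
    W ⊢ while e c , σ ⇓ σ , (1 + cost e)

-- i-th entry, or the default beyond the end.
at : ∀ {A : Set} → A → List A → ℕ → A
at z []       i       = z
at z (x ∷ xs) zero    = x
at z (x ∷ xs) (suc i) = at z xs i

-- Array a initially holds the a-th list; all remaining cells are 0.
load : List (List ℕ) → Store
load xss a i = at 0 (at [] xss a) i

-- Two-sided Dedekind cuts: L q is q < x, U q is x < q.
record ℝ : Set₁ where
  field
    L U         : ℚ → Set
    L-inhabited : ∃[ q ] L q
    U-inhabited : ∃[ q ] U q
    L-rounded   : ∀ q → L q ⇔ (∃[ r ] (q <ℚ r × L r))
    U-rounded   : ∀ q → U q ⇔ (∃[ r ] (r <ℚ q × U r))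
    disjoint    : ∀ q → L q → U q → ⊥
    located     : ∀ q r → q <ℚ r → L q ⊎ U r

_<ʳ_ : ℝ → ℚ → Set
x <ʳ q = ℝ.U x q

-- t ≤ C (n^ω + y), for n ≥ 1 and ω ≥ 0.  As n^ω is the infimum of n^(p/q) over
-- the rationals p/q > ω, this says t - C y ≤ C n^(p/q) for all of these; both
-- sides are then raised to the q-th power.  Truncated subtraction is harmless:
-- the inequality holds anyway when t ≤ C y.
_≤_·[_^_+_] : ℕ → ℕ → ℕ → ℝ → ℕ → Set
t ≤ C ·[ n ^ ω + y ] =
  ∀ (p q : ℕ) .{{_ : NonZero q}} → ω <ʳ (+ p / q) →
  (t ∸ C * y) ** q ≤ (C ** q) * (n ** p)

record Problem : Set₁ where
  field
    Instance : Set
    encode   : Instance → List (List ℕ)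
    size     : Instance → ℕ
    Correct  : Instance → Store → Set

-- P is solvable in time O(ν^ω + f): one program and one constant C for all
-- instances, on words of O(log size) bits.  The time bound concerns ν ≥ 1 only
-- (0^ω = 0 leaves no time at all); correctness is required on every instance.
SolvableInO : (P : Problem) (ν : Problem.Instance P → ℕ) (ω : ℝ)
              (f : Problem.Instance P → ℕ) → Set
SolvableInO P ν ω f =
  ∃[ prog ] ∃[ C ] ∃[ d ] ∀ (x : Instance) →
    ∃[ σ ] ∃[ t ]
      (((2 + size x) ** d) ⊢ prog , load (encode x) ⇓ σ , t) ×
      Correct x σ ×
      (1 ≤ ν x → t ≤ C ·[ ν x ^ ω + f x ])
  where open Problem P

-- The cell value b is the truth value of A.
_Decides_ : ℕ → Set → Set
b Decides A = (b ≡ 1 × A) ⊎ (b ≡ 0 × ¬ A)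

firsts seconds : ∀ {n} → List (Fin n × Fin n) → List ℕ
firsts  = map (λ e → toℕ (proj₁ e))
seconds = map (λ e → toℕ (proj₂ e))

-- Array 0: n, m; array 1: tails of the arcs; array 2: heads of the arcs.
-- Result: the n × n reachability matrix, row by row, in array 3.
transitiveClosure : Problem
transitiveClosure = record
  { Instance = DAG
  ; encode   = λ G → let open DAG G in
      (n ∷ m ∷ []) ∷ firsts arcs ∷ seconds arcs ∷ []
  ; size     = λ G → let open DAG G in n + m
  ; Correct  = λ G σ → let open DAG G in
      ∀ (u v : Vertex) → σ 3 (toℕ u * n + toℕ v) Decides Path u v
  }

record LCAInstance : Set where
  field
    graph : DAG
  open DAG graph public
  field
    pairs : List (Vertex × Vertex)
  k : ℕ
  k = length pairs

-- Array 0: n, m, k; arrays 1, 2: the arcs as above; arrays 3, 4: first and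
-- second members of the pairs.  Result, in array 5: for each pair, the set of
-- its LCAs as a 0/1 row of length n.
allLCAs : Problem
allLCAs = record
  { Instance = LCAInstance
  ; encode   = λ I → let open LCAInstance I in
      (n ∷ m ∷ k ∷ []) ∷ firsts arcs ∷ seconds arcs ∷ firsts pairs ∷ seconds pairs ∷ []
  ; size     = λ I → let open LCAInstance I in n + m + k
  ; Correct  = λ I σ → let open LCAInstance I in
      ∀ (j : Fin k) (s : Vertex) →
        σ 5 (toℕ j * n + toℕ s) Decides
          IsLCA s (proj₁ (lookup pairs j)) (proj₂ (lookup pairs j))
  }

{-# OPTIONS --safe #-}
module Submission where

-- If k = 0 nothing has to be output and O(1) steps suffice.  If k ≥ 1, then
-- n² ≤ n²k, and the program below stays within O(nm + n²k) steps.
--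
-- Junctions are recognised by dominators.  Fix a source s.  Give s the label s,
-- and give a vertex x ≠ s reachable from s the label of the topmost vertex l ≠ s
-- that lies on every path from s to x (x itself qualifies, so l exists).  Then s
-- is a junction of u ≠ v iff both are labelled and their labels differ: a common
-- label l ≠ s lies on all paths to u and to v, and conversely different labels
-- admit internally disjoint paths (`junction⇒separated`, `separated⇒junction`).
--
-- The labels from s are found in one pass over the arcs, sorted by the level
-- (length of a longest incoming path) of their heads.  When the arc (p , x) is
-- added, x has as yet no outgoing arc, so only the label of x can change: it
-- becomes the label of p if x was unreached, and x if p = s or if the labels of
-- p and x disagree.  `AddArc.relax-labelling` shows that this preserves the
-- characterisation of the labels, including the existence of disjoint paths,
-- which are never constructed by an appeal to Menger's theorem but only extended
-- by one arc.
--
-- Levels come from n rounds of relaxation over the m arcs (`findLevels-correct`),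
-- the sorting is a scan of the arcs for each of the n levels
-- (`sortArcs-correct`), the labels of all n sources take n passes over the m arcs
-- (`labelAll-correct`), and for each pair every s is compared with every s′ to
-- discard the junctions that reach another junction (`markAll-correct`);
-- reachability is read off the labels.
--
-- The program uses only loops with a limit fixed in advance, so its running time
-- is bounded by a polynomial computed from its text.  An assignment stores at
-- most the largest value present plus 1, hence the time bound, added to the
-- largest input value, also bounds all values, and no overflow occurs on words
-- of O(log size) bits (`adequate`).

open import Defs
open import Data.Bool.Base using (Bool; true; false; if_then_else_; _∧_; _∨_; not)
open import Data.Empty using (⊥-elim)
open import Data.Fin.Base as Fin using (Fin; toℕ; fromℕ<; combine)
open import Data.Fin.Properties using (_≟_; toℕ-injective; toℕ<n; toℕ-fromℕ<; toℕ-combine; combine-injective; pigeonhole)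
open import Data.Integer.Base using (+_)
open import Data.List.Base using (List; []; _∷_; length; lookup; map)
open import Data.List.Membership.Propositional using (_∈_)
open import Data.List.Membership.Propositional.Properties using (∈-lookup)
open import Data.List.Relation.Binary.Subset.Propositional using (_⊆_)
open import Data.List.Relation.Unary.All as All using (All; []; _∷_)
open import Data.List.Relation.Unary.All.Properties using (map⁺)
open import Data.List.Relation.Unary.Any as Any using (here; there)
open import Data.List.Relation.Unary.Any.Properties using (lookup-index)
open import Data.Nat.Base using (ℕ; zero; suc; _+_; _*_; _^_; _≤_; _<_; z≤n; s≤s; _≡ᵇ_; _<ᵇ_; NonZero; >-nonZero)
import Data.Nat.Properties as ℕ
open import Data.Nat.Solver using (module +-*-Solver)
open import Data.Product.Base using (_×_; _,_; proj₁; proj₂; Σ-syntax; ∃-syntax)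
open import Data.Rational.Base using (_/_)
open import Data.Sum.Base using (_⊎_; inj₁; inj₂; [_,_]′)
open import Relation.Binary.Construct.Closure.ReflexiveTransitive as Star using (Star; ε; _◅_; _◅◅_)
open import Relation.Binary.Construct.Closure.Transitive as Plus using (TransClosure)
open import Relation.Binary.PropositionalEquality hiding ([_])
open import Relation.Nullary using (¬_; yes; no)

-- Paths in a growing graph and dominator labels

module _ {V : Set} where

  -- The vertices of a path, both ends included.
  trace : {R : V → V → Set} {a b : V} → Star R a b → List V
  trace {a = a} ε       = a ∷ []
  trace {a = a} (_ ◅ P) = a ∷ trace P

  -- Internally disjoint: only the common source s lies on both paths.
  Disjoint : {R : V → V → Set} {s u v : V} → Star R s u → Star R s v → Set
  Disjoint {s = s} P Q = ∀ x → x ∈ trace P → x ∈ trace Q → x ≡ s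

  module _ {R : V → V → Set} where

    end∈trace : ∀ {a b} (P : Star R a b) → b ∈ trace P
    end∈trace ε       = here refl
    end∈trace (_ ◅ P) = there (end∈trace P)

    trace-snoc : ∀ {a b c} (P : Star R a b) (r : R b c) {x : V} →
      x ∈ trace (P ◅◅ (r ◅ ε)) → x ∈ trace P ⊎ x ≡ c
    trace-snoc ε r (here e)          = inj₁ (here e)
    trace-snoc ε r (there (here e))  = inj₂ e
    trace-snoc (q ◅ P) r (here e)    = inj₁ (here e)
    trace-snoc (q ◅ P) r (there x∈)  with trace-snoc P r x∈
    ... | inj₁ x∈P = inj₁ (there x∈P)
    ... | inj₂ e   = inj₂ e

    sink-is-end : ∀ {x} → (∀ {b} → ¬ R x b) →
      ∀ {a b} (P : Star R a b) → x ∈ trace P → x ≡ b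
    sink-is-end sink ε       (here e)    = e
    sink-is-end sink (r ◅ P) (here refl) = ⊥-elim (sink r)
    sink-is-end sink (r ◅ P) (there x∈)  = sink-is-end sink P x∈

  trace-map : {R S : V → V → Set} (f : ∀ {a b} → R a b → S a b) →
    ∀ {a b} (P : Star R a b) → trace (Star.map f P) ≡ trace P
  trace-map f ε       = refl
  trace-map f (r ◅ P) = cong (_ ∷_) (trace-map f P)

-- `label` is the labelling of the vertices reachable from s in R: 0 means
-- unreachable, suc (toℕ l) stands for the label l.  That l is the topmost
-- dominator is not recorded; its consequence `disjoint` is.
record Labelling {n : ℕ} (R : Fin n → Fin n → Set) (s : Fin n)
                 (label : Fin n → ℕ) : Set where
  field
    root     : label s ≡ suc (toℕ s)
    sound    : ∀ x → label x ≢ 0 → Star R s x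
    complete : ∀ x → Star R s x → label x ≢ 0
    not-root : ∀ x l → x ≢ s → label x ≡ suc (toℕ l) → l ≢ s
    dominate : ∀ x l → x ≢ s → label x ≡ suc (toℕ l) →
               ∀ (P : Star R s x) → l ∈ trace P
    is-vertex : ∀ x → label x ≢ 0 → Σ[ l ∈ Fin n ] label x ≡ suc (toℕ l)
    disjoint : ∀ x y → label x ≢ 0 → label y ≢ 0 → label x ≢ label y →
               Σ[ P ∈ Star R s x ] Σ[ Q ∈ Star R s y ] Disjoint P Q

-- The new label of x when the arc (p , x) is added, given the labels a of p and
-- b of x.  In the case `meeting` only s and x lie on all paths from s to x: either the
-- arc itself starts at s, or two different labels meet in x.
data Relaxed {n : ℕ} (s p x : Fin n) (a b : ℕ) : ℕ → Set where
  unreached : a ≡ 0 → Relaxed s p x a b b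
  agreeing  : a ≢ 0 → b ≡ a → Relaxed s p x a b b
  first     : a ≢ 0 → b ≡ 0 → p ≢ s → Relaxed s p x a b a
  meeting   : a ≢ 0 → b ≢ a → p ≡ s ⊎ b ≢ 0 → Relaxed s p x a b (suc (toℕ x))

-- R′ is R with an additional arc (p , x) into a sink x.
module AddArc {n : ℕ} {R R′ : Fin n → Fin n → Set} {p x : Fin n}
  (lift : ∀ {a b} → R a b → R′ a b)
  (new  : R′ p x)
  (only : ∀ {a b} → R′ a b → R a b ⊎ (a ≡ p × b ≡ x))
  (sink : ∀ {b} → ¬ R x b)
  (p≢x  : p ≢ x) where

  -- A path in R′ is a path in R or a path in R to p followed by the new arc; it
  -- cannot go on after x.
  split : ∀ {a y} (P : Star R′ a y) →
    (Σ[ Q ∈ Star R a y ] trace Q ⊆ trace P) ⊎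
    (y ≡ x × (Σ[ Q ∈ Star R a p ] trace Q ⊆ trace P))
  split ε = inj₁ (ε , λ z → z)
  split (r ◅ P) with only r | split P
  ... | inj₁ r₀ | inj₁ (Q , Q⊆) =
        inj₁ (r₀ ◅ Q , λ { (here e) → here e ; (there z) → there (Q⊆ z) })
  ... | inj₁ r₀ | inj₂ (e , Q , Q⊆) =
        inj₂ (e , r₀ ◅ Q , λ { (here e) → here e ; (there z) → there (Q⊆ z) })
  ... | inj₂ (refl , refl) | inj₁ (ε , Q⊆) =
        inj₂ (refl , ε , λ { (here e) → here e })
  ... | inj₂ (refl , refl) | inj₁ (r₀ ◅ _ , _) = ⊥-elim (sink r₀)
  ... | inj₂ (refl , refl) | inj₂ (_ , ε , _) = ⊥-elim (p≢x refl)
  ... | inj₂ (refl , refl) | inj₂ (_ , r₀ ◅ _ , _) = ⊥-elim (sink r₀)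

  lift⋆ : ∀ {a b} → Star R a b → Star R′ a b
  lift⋆ = Star.map lift

  lift-disjoint : ∀ {s u v} (P : Star R s u) (Q : Star R s v) →
    Disjoint P Q → Disjoint (lift⋆ P) (lift⋆ Q)
  lift-disjoint P Q D z z∈P z∈Q =
    D z (subst (z ∈_) (trace-map lift P) z∈P) (subst (z ∈_) (trace-map lift Q) z∈Q)

  module _ {s : Fin n} {label label′ : Fin n → ℕ} (L : Labelling R s label)
    (x≢s  : label p ≢ 0 → x ≢ s)
    (same : ∀ y → y ≢ x → label′ y ≡ label y)
    (relaxed : Relaxed s p x (label p) (label x) (label′ x)) where

    open Labelling L

    private
      transport : ∀ {y} → y ≢ x → label′ y ≢ 0 → label y ≢ 0
      transport y≢x ≢0 e = ≢0 (trans (same _ y≢x) e)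

      through-p : label p ≢ 0 → Star R′ s x
      through-p a≢0 = lift⋆ (sound p a≢0) ◅◅ (new ◅ ε)

      Sep : Fin n → Fin n → Set
      Sep y z = Σ[ P ∈ Star R′ s y ] Σ[ Q ∈ Star R′ s z ] Disjoint P Q

      swap : ∀ {y z} → Sep y z → Sep z y
      swap (P , Q , D) = Q , P , λ w w∈Q w∈P → D w w∈P w∈Q

      old-disjoint : ∀ y z → label y ≢ 0 → label z ≢ 0 → label y ≢ label z → Sep y z
      old-disjoint y z y≢0 z≢0 y≢z with disjoint y z y≢0 z≢0 y≢z
      ... | P , Q , D = lift⋆ P , lift⋆ Q , lift-disjoint P Q D

      -- Disjoint paths to p and z ≠ x stay disjoint when the first is prolonged to
      -- x, since the sink x does not lie on a path to z.
      extend : ∀ {z} → z ≢ x → (P : Star R s p) (Q : Star R s z) → Disjoint P Q → Sep x z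
      extend z≢x P Q D = lift⋆ P ◅◅ (new ◅ ε) , lift⋆ Q , D′
        where
        D′ : Disjoint (lift⋆ P ◅◅ (new ◅ ε)) (lift⋆ Q)
        D′ w w∈P w∈Q with trace-snoc (lift⋆ P) new w∈P
        ... | inj₁ w∈P₀ = lift-disjoint P Q D w w∈P₀ w∈Q
        ... | inj₂ refl =
              ⊥-elim (z≢x (sym (sink-is-end sink Q (subst (w ∈_) (trace-map lift Q) w∈Q))))

      via-p : ∀ z → z ≢ x → label z ≢ 0 → label p ≢ 0 → p ≡ s ⊎ label p ≢ label z → Sep x z
      via-p z z≢x z≢0 p≢0 (inj₁ refl) =
        extend z≢x ε (sound z z≢0) λ { w (here e) _ → e }
      via-p z z≢x z≢0 p≢0 (inj₂ p≢z) with disjoint p z p≢0 z≢0 p≢z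
      ... | P , Q , D = extend z≢x P Q D

      disjoint-x : ∀ z → z ≢ x → label z ≢ 0 → ∀ {b} → Relaxed s p x (label p) (label x) b →
        b ≢ 0 → b ≢ label z → Sep x z
      disjoint-x z z≢x z≢0 (unreached _)  b≢0 b≢z = old-disjoint x z b≢0 z≢0 b≢z
      disjoint-x z z≢x z≢0 (agreeing _ _) b≢0 b≢z = old-disjoint x z b≢0 z≢0 b≢z
      disjoint-x z z≢x z≢0 (first a≢0 _ _) _ b≢z = via-p z z≢x z≢0 a≢0 (inj₂ b≢z)
      disjoint-x z z≢x z≢0 (meeting a≢0 _ (inj₁ e)) _ _ = via-p z z≢x z≢0 a≢0 (inj₁ e)
      disjoint-x z z≢x z≢0 (meeting a≢0 x≢p (inj₂ x≢0)) _ _ with label x ℕ.≟ label z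
      ... | no x≢z  = old-disjoint x z x≢0 z≢0 x≢z
      -- z has the label of x, hence not that of p.
      ... | yes x≡z = via-p z z≢x z≢0 a≢0 (inj₂ λ p≡z → x≢p (trans x≡z (sym p≡z)))

      root-x : x ≡ s → ∀ {b} → Relaxed s p x (label p) (label x) b → b ≡ suc (toℕ s)
      root-x refl (unreached _)     = root
      root-x refl (agreeing a≢0 _)  = root
      root-x refl (first a≢0 _ _)   = ⊥-elim (x≢s a≢0 refl)
      root-x refl (meeting a≢0 _ _) = refl

      sound-x : ∀ {b} → Relaxed s p x (label p) (label x) b → b ≢ 0 → Star R′ s x
      sound-x (unreached _)     b≢0 = lift⋆ (sound x b≢0)
      sound-x (agreeing _ _)    b≢0 = lift⋆ (sound x b≢0)
      sound-x (first a≢0 _ _)   _   = through-p a≢0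
      sound-x (meeting a≢0 _ _) _   = through-p a≢0

      complete-x : ∀ {b} → Relaxed s p x (label p) (label x) b →
        label p ≢ 0 ⊎ label x ≢ 0 → b ≢ 0
      complete-x (unreached a≡0)    (inj₁ a≢0) = ⊥-elim (a≢0 a≡0)
      complete-x (unreached _)      (inj₂ b≢0) = b≢0
      complete-x (agreeing a≢0 b≡a) _          = λ b≡0 → a≢0 (trans (sym b≡a) b≡0)
      complete-x (first a≢0 _ _)    _          = a≢0
      complete-x (meeting _ _ _)    _          = λ ()

      is-vertex-x : ∀ {b} → Relaxed s p x (label p) (label x) b → b ≢ 0 →
        Σ[ l ∈ Fin n ] b ≡ suc (toℕ l)
      is-vertex-x (unreached _)   b≢0 = is-vertex x b≢0
      is-vertex-x (agreeing _ _)  b≢0 = is-vertex x b≢0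
      is-vertex-x (first _ _ _)   b≢0 = is-vertex p b≢0
      is-vertex-x (meeting _ _ _) _   = x , refl

      not-root-x : ∀ {b} → Relaxed s p x (label p) (label x) b → ∀ l → x ≢ s →
        b ≡ suc (toℕ l) → l ≢ s
      not-root-x (unreached _)     l x≢s e = not-root x l x≢s e
      not-root-x (agreeing _ _)    l x≢s e = not-root x l x≢s e
      not-root-x (first _ _ p≢s)   l _   e = not-root p l p≢s e
      not-root-x (meeting _ _ _)   l x≢s e l≡s =
        x≢s (trans (toℕ-injective (ℕ.suc-injective e)) l≡s)

      dominate-x : ∀ {b} → Relaxed s p x (label p) (label x) b → ∀ l → x ≢ s →
        b ≡ suc (toℕ l) → (P : Star R′ s x) → l ∈ trace P
      dominate-x (meeting _ _ _) l x≢s e P =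
        subst (_∈ trace P) (toℕ-injective (ℕ.suc-injective e)) (end∈trace P)
      dominate-x (unreached a≡0) l x≢s e P with split P
      ... | inj₁ (Q , Q⊆)     = Q⊆ (dominate x l x≢s e Q)
      ... | inj₂ (_ , Q , _)  = ⊥-elim (complete p Q a≡0)
      dominate-x (first _ b≡0 p≢s) l x≢s e P with split P
      ... | inj₁ (Q , _)      = ⊥-elim (complete x Q b≡0)
      ... | inj₂ (_ , Q , Q⊆) = Q⊆ (dominate p l p≢s e Q)
      dominate-x (agreeing a≢0 b≡a) l x≢s e P with split P | p ≟ s
      ... | inj₁ (Q , Q⊆)     | _        = Q⊆ (dominate x l x≢s e Q)
      ... | inj₂ (_ , Q , Q⊆) | no p≢s   = Q⊆ (dominate p l p≢s (trans (sym b≡a) e) Q)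
      ... | inj₂ _            | yes refl = ⊥-elim (not-root x p x≢s (trans b≡a root) refl)

    relax-labelling : Labelling R′ s label′
    relax-labelling = record
      { root = root′ ; sound = sound′ ; complete = complete′ ; not-root = not-root′
      ; dominate = dominate′ ; is-vertex = is-vertex′ ; disjoint = disjoint′ }
      where
      root′ : label′ s ≡ suc (toℕ s)
      root′ with s ≟ x
      ... | yes s≡x = subst (λ w → label′ w ≡ suc (toℕ s)) (sym s≡x) (root-x (sym s≡x) relaxed)
      ... | no s≢x  = trans (same s s≢x) root

      sound′ : ∀ y → label′ y ≢ 0 → Star R′ s y
      sound′ y y≢0 with y ≟ x
      ... | yes refl = sound-x relaxed y≢0
      ... | no y≢x   = lift⋆ (sound y (transport y≢x y≢0))

      complete′ : ∀ y → Star R′ s y → label′ y ≢ 0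
      complete′ y P with y ≟ x | split P
      ... | yes refl | inj₁ (Q , _)     = complete-x relaxed (inj₂ (complete y Q))
      ... | yes refl | inj₂ (_ , Q , _) = complete-x relaxed (inj₁ (complete p Q))
      ... | no y≢x   | inj₁ (Q , _)     = λ e → complete y Q (trans (sym (same y y≢x)) e)
      ... | no y≢x   | inj₂ (y≡x , _)   = ⊥-elim (y≢x y≡x)

      not-root′ : ∀ y l → y ≢ s → label′ y ≡ suc (toℕ l) → l ≢ s
      not-root′ y l y≢s e with y ≟ x
      ... | yes refl = not-root-x relaxed l y≢s e
      ... | no y≢x   = not-root y l y≢s (trans (sym (same y y≢x)) e)

      dominate′ : ∀ y l → y ≢ s → label′ y ≡ suc (toℕ l) → ∀ (P : Star R′ s y) → l ∈ trace P
      dominate′ y l y≢s e P with y ≟ x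
      ... | yes refl = dominate-x relaxed l y≢s e P
      ... | no y≢x with split P
      ...   | inj₁ (Q , Q⊆) = Q⊆ (dominate y l y≢s (trans (sym (same y y≢x)) e) Q)
      ...   | inj₂ (y≡x , _) = ⊥-elim (y≢x y≡x)

      is-vertex′ : ∀ y → label′ y ≢ 0 → Σ[ l ∈ Fin n ] label′ y ≡ suc (toℕ l)
      is-vertex′ y y≢0 with y ≟ x
      ... | yes refl = is-vertex-x relaxed y≢0
      ... | no y≢x with is-vertex y (transport y≢x y≢0)
      ...   | l , e = l , trans (same y y≢x) e

      disjoint′ : ∀ y z → label′ y ≢ 0 → label′ z ≢ 0 → label′ y ≢ label′ z → Sep y z
      disjoint′ y z y≢0 z≢0 y≢z with y ≟ x | z ≟ x
      ... | yes refl | yes refl = ⊥-elim (y≢z refl)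
      ... | yes refl | no z≢x   = disjoint-x z z≢x (transport z≢x z≢0) relaxed y≢0
                                    (λ e → y≢z (trans e (sym (same z z≢x))))
      ... | no y≢x   | yes refl = swap (disjoint-x y y≢x (transport y≢x y≢0) relaxed z≢0
                                    (λ e → y≢z (trans (same y y≢x) (sym e))))
      ... | no y≢x   | no z≢x   = old-disjoint y z (transport y≢x y≢0) (transport z≢x z≢0)
                                    (λ e → y≢z (trans (same y y≢x) (trans e (sym (same z z≢x)))))

labelling-no-arcs : ∀ {n} {R : Fin n → Fin n → Set} {s : Fin n} {label : Fin n → ℕ} →
  (∀ {a b} → ¬ R a b) → label s ≡ suc (toℕ s) → (∀ x → x ≢ s → label x ≡ 0) →
  Labelling R s label
labelling-no-arcs {R = R} {s} {label} none at-s elsewhere = record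
  { root      = at-s
  ; sound     = sound
  ; complete  = complete
  ; not-root  = λ x l x≢s e → ⊥-elim (0≢suc x x≢s e)
  ; dominate  = λ x l x≢s e → ⊥-elim (0≢suc x x≢s e)
  ; is-vertex = λ x x≢0 → s , trans (cong label (only-s x x≢0)) at-s
  ; disjoint  = λ x y x≢0 y≢0 x≢y →
      ⊥-elim (x≢y (cong label (trans (only-s x x≢0) (sym (only-s y y≢0)))))
  }
  where
  0≢suc : ∀ x {k} → x ≢ s → label x ≢ suc k
  0≢suc x x≢s e with trans (sym (elsewhere x x≢s)) e
  ... | ()

  only-s : ∀ x → label x ≢ 0 → x ≡ s
  only-s x x≢0 with x ≟ s
  ... | yes e  = e
  ... | no x≢s = ⊥-elim (x≢0 (elsewhere x x≢s))

  sound : ∀ x → label x ≢ 0 → Star R s x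
  sound x x≢0 with only-s x x≢0
  ... | refl = ε

  complete : ∀ x → Star R s x → label x ≢ 0
  complete x ε e       with trans (sym at-s) e
  ... | ()
  complete x (r ◅ _) _ = none r

labelling-resp : ∀ {n} {R S : Fin n → Fin n → Set} {s : Fin n} {label label′ : Fin n → ℕ} →
  (∀ {a b} → R a b → S a b) → (∀ {a b} → S a b → R a b) → (∀ x → label x ≡ label′ x) →
  Labelling R s label → Labelling S s label′
labelling-resp {n} {R} {S} {s} {label} {label′} f g eq L = record
  { root      = trans (sym (eq s)) root
  ; sound     = λ x x≢0 → Star.map f (sound x (back x≢0))
  ; complete  = λ x P e → complete x (Star.map g P) (trans (eq x) e)
  ; not-root  = λ x l x≢s e → not-root x l x≢s (trans (eq x) e)
  ; dominate  = λ x l x≢s e P →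
      subst (l ∈_) (trace-map g P) (dominate x l x≢s (trans (eq x) e) (Star.map g P))
  ; is-vertex = λ x x≢0 → subst (λ v → Σ[ l ∈ Fin n ] v ≡ suc (toℕ l)) (eq x) (is-vertex x (back x≢0))
  ; disjoint  = λ x y x≢0 y≢0 x≢y →
      let P , Q , D = disjoint x y (back x≢0) (back y≢0)
                        (λ e → x≢y (trans (sym (eq x)) (trans e (eq y))))
      in Star.map f P , Star.map f Q ,
         λ z z∈P z∈Q → D z (subst (z ∈_) (trace-map f P) z∈P) (subst (z ∈_) (trace-map f Q) z∈Q)
  }
  where
  open Labelling L
  back : ∀ {x} → label′ x ≢ 0 → label x ≢ 0
  back {x} x≢0 e = x≢0 (trans (sym (eq x)) e)

-- Two vertices carry different labels, neither being unreachable.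
Separated : ℕ → ℕ → Set
Separated a b = a ≢ 0 × b ≢ 0 × a ≢ b

module _ (G : DAG) where
  open DAG G

  vertices≡trace : ∀ {u v} (P : Path u v) → vertices P ≡ trace P
  vertices≡trace ε       = refl
  vertices≡trace (r ◅ P) = cong (_ ∷_) (vertices≡trace P)

  module _ {s : Vertex} {label : Vertex → ℕ} (L : Labelling Arc s label) where
    open Labelling L

    separated⇒junction : ∀ {u v} → Separated (label u) (label v) → IsJunction s u v
    separated⇒junction {u} {v} (u≢0 , v≢0 , u≢v) with disjoint u v u≢0 v≢0 u≢v
    ... | P , Q , D =
      (λ e → u≢v (cong label e)) , P , Q ,
      λ x x∈P x∈Q → D x (subst (x ∈_) (vertices≡trace P) x∈P)
                        (subst (x ∈_) (vertices≡trace Q) x∈Q)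

    junction⇒separated : ∀ {u v} → IsJunction s u v → Separated (label u) (label v)
    junction⇒separated {u} {v} (u≢v , P , Q , D) = complete u P , complete v Q , λ e → apart e
      where
      apart : label u ≢ label v
      apart e with is-vertex u (complete u P) | u ≟ s | v ≟ s
      ... | _ , _ | yes refl | yes refl = u≢v refl
      ... | _ , _ | yes refl | no v≢s   = not-root v s v≢s (trans (sym e) root) refl
      ... | _ , _ | no u≢s   | yes refl = not-root u s u≢s (trans e root) refl
      ... | l , e′ | no u≢s  | no v≢s   =
        not-root u l u≢s e′
          (D l (subst (l ∈_) (sym (vertices≡trace P)) (dominate u l u≢s e′ P))
               (subst (l ∈_) (sym (vertices≡trace Q)) (dominate v l v≢s (trans (sym e) e′) Q)))

-- Loop programs on the word RAM: semantics, running time and overflow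

infixr 5 _then_

-- Programs whose only loops are counting loops, and whose assignments are
-- a[i] := c and a[i] := b[j] + c.  `loop r l p` runs p with the register r = 0, 1, …
-- below the limit held in cell l of array 0.
data Prog : Set where
  pass   : Prog
  put    : (a : Name) (i : Expr) (c : ℕ) → Prog
  copy   : (a : Name) (i : Expr) (b : Name) (j : Expr) (c : ℕ) → Prog
  _then_ : Prog → Prog → Prog
  test   : Expr → Prog → Prog → Prog
  loop   : (r : Name) (l : ℕ) → Prog → Prog

incr : Name → Cmd
incr r = r [ lit 0 ]≔ ((r [ lit 0 ]) ⊕ lit 1)

guard : Name → ℕ → Expr
guard r l = (r [ lit 0 ]) ≺ (0 [ lit l ])

compile : Prog → Cmd
compile pass             = skip
compile (put a i c)      = a [ i ]≔ lit c
compile (copy a i b j c) = a [ i ]≔ ((b [ j ]) ⊕ lit c)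
compile (p then q)       = compile p ⨟ compile q
compile (test e p q)     = ifte e (compile p) (compile q)
compile (loop r l p)     = (r [ lit 0 ]≔ lit 0) ⨟ while (guard r l) (compile p ⨟ incr r)

-- The first alternative on nonzero values, the second on 0.
branch : {A : Set} → ℕ → A → A → A
branch zero    x y = y
branch (suc _) x y = x

iterate : {A : Set} → (A → A) → ℕ → A → A
iterate f zero    x = x
iterate f (suc k) x = iterate f k (f x)

bump : Name → Store → Store
bump r σ = update σ r 0 (σ r 0 + 1)

-- The final store.  A loop body must not change the loop register and no program
-- may write to array 0; see `ok` and `adequate`.
run : Prog → Store → Store
run pass             σ = σ
run (put a i c)      σ = update σ a (eval σ i) c
run (copy a i b j c) σ = update σ a (eval σ i) (σ b (eval σ j) + c)
run (p then q)       σ = run q (run p σ)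
run (test e p q)     σ = branch (eval σ e) (run p σ) (run q σ)
run (loop r l p)     σ = iterate (λ τ → bump r (run p τ)) (σ 0 l) (update σ r 0 0)

-- Bound on the running time when array 0 holds the limits N.  The stored
-- constants c are included so that it also bounds the growth of the values in
-- memory.
bound : (ℕ → ℕ) → Prog → ℕ
bound N pass             = 1
bound N (put a i c)      = c + (1 + cost i + 1)
bound N (copy a i b j c) = c + (1 + cost i + (1 + (1 + cost j) + 1))
bound N (p then q)       = bound N p + bound N q
bound N (test e p q)     = 1 + cost e + (bound N p + bound N q)
-- 9: initialisation of the register and last evaluation of the guard;
-- 12: the guard and the increment of each iteration.
bound N (loop r l p)     = 9 + N l * (12 + bound N p)

-- Whether the program contains an assignment to the array b.
writes : Prog → Name → Bool
writes pass b             = false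
writes (put a i c) b      = a ≡ᵇ b
writes (copy a i _ j c) b = a ≡ᵇ b
writes (p then q) b       = writes p b ∨ writes q b
writes (test e p q) b     = writes p b ∨ writes q b
writes (loop r l p) b     = (r ≡ᵇ b) ∨ writes p b

-- No loop body assigns to its own loop register.
ok : Prog → Bool
ok (p then q)   = ok p ∧ ok q
ok (test e p q) = ok p ∧ ok q
ok (loop r l p) = not (writes p r) ∧ ok p
ok _            = true

∨-false : ∀ x {y} → x ∨ y ≡ false → x ≡ false × y ≡ false
∨-false false e = refl , e

∧-true : ∀ x {y} → x ∧ y ≡ true → x ≡ true × y ≡ true
∧-true true e = refl , e

not-true : ∀ {x} → not x ≡ true → x ≡ false
not-true {false} _ = refl

≡ᵇ-refl : ∀ k → (k ≡ᵇ k) ≡ true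
≡ᵇ-refl zero    = refl
≡ᵇ-refl (suc k) = ≡ᵇ-refl k

update-same : ∀ σ a i v → update σ a i v a i ≡ v
update-same σ a i v rewrite ≡ᵇ-refl a | ≡ᵇ-refl i = refl

update-other : ∀ σ a i v {b} j → (a ≡ᵇ b) ≡ false → update σ a i v b j ≡ σ b j
update-other σ a i v j e rewrite e = refl

iterate-inv : {A : Set} (f : A → A) (I : ℕ → A → Set) → ∀ k i {x} → I i x →
  (∀ j {y} → i ≤ j → j < i + k → I j y → I (suc j) (f y)) → I (i + k) (iterate f k x)
iterate-inv f I zero    i {x} base step = subst (λ j → I j x) (sym (ℕ.+-identityʳ i)) base
iterate-inv f I (suc k) i {x} base step =
  subst (λ j → I j (iterate f k (f x))) (sym (ℕ.+-suc i k))
    (iterate-inv f I k (suc i)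
      (step i ℕ.≤-refl (ℕ.m<m+n i (s≤s z≤n)) base)
      λ j i<j j< → step j (ℕ.<⇒≤ i<j) (ℕ.<-≤-trans j< (ℕ.≤-reflexive (sym (ℕ.+-suc i k)))))

branch-elim : {A : Set} (P : A → Set) (v : ℕ) {x y : A} →
  (v ≢ 0 → P x) → (v ≡ 0 → P y) → P (branch v x y)
branch-elim P zero    f g = g refl
branch-elim P (suc v) f g = f λ ()

frame : ∀ p {b} → writes p b ≡ false → ∀ σ x → run p σ b x ≡ σ b x
frame pass             e σ x = refl
frame (put a i c)      e σ x = update-other σ a (eval σ i) c x e
frame (copy a i b j c) e σ x = update-other σ a (eval σ i) (σ b (eval σ j) + c) x e
frame (p then q)       e σ x with ∨-false (writes p _) e
... | e₁ , e₂ = trans (frame q e₂ (run p σ) x) (frame p e₁ σ x)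
frame (test c p q) {b} e σ x with ∨-false (writes p _) e
... | e₁ , e₂ = branch-elim (λ τ → τ b x ≡ σ b x) (eval σ c) {run p σ} {run q σ}
                  (λ _ → frame p e₁ σ x) (λ _ → frame q e₂ σ x)
frame (loop r l p) {b} e σ x with ∨-false (r ≡ᵇ b) e
... | e₁ , e₂ =
  iterate-inv (λ τ → bump r (run p τ)) (λ _ τ → τ b x ≡ σ b x) (σ 0 l) 0
    (update-other σ r 0 0 x e₁)
    (λ _ {τ} _ _ τ≡σ →
      trans (update-other (run p τ) r 0 (run p τ r 0 + 1) x e₁) (trans (frame p e₂ τ x) τ≡σ))

-- Invariant rule.  An iteration may use that the arrays which the loop does not
-- write are as they were before the loop.
loop-rule : ∀ r l p σ (I : ℕ → Store → Set) → writes p r ≡ false →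
  I 0 (update σ r 0 0) →
  (∀ i τ → i < σ 0 l → τ r 0 ≡ i →
    (∀ b x → writes (loop r l p) b ≡ false → τ b x ≡ σ b x) →
    I i τ → I (suc i) (bump r (run p τ))) →
  I (σ 0 l) (run (loop r l p) σ)
loop-rule r l p σ I r∉p base step = proj₂ (proj₂
  (iterate-inv (λ τ → bump r (run p τ))
    (λ i τ → τ r 0 ≡ i × (∀ b x → writes (loop r l p) b ≡ false → τ b x ≡ σ b x) × I i τ)
    (σ 0 l) 0
    (update-same σ r 0 0 , (λ b x e → update-other σ r 0 0 x (proj₁ (∨-false (r ≡ᵇ b) e))) , base)
    λ i {τ} _ i< (at-r , same , inv) →
      trans (update-same (run p τ) r 0 _)
        (trans (cong (_+ 1) (trans (frame p r∉p τ 0) at-r)) (ℕ.+-comm i 1)) ,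
      (λ b x e → let e₁ , e₂ = ∨-false (r ≡ᵇ b) e in
        trans (update-other (run p τ) r 0 _ x e₁) (trans (frame p e₂ τ x) (same b x e))) ,
      step i τ i< at-r same inv))

-- Every cell holds at most V.
Bounded : ℕ → Store → Set
Bounded V σ = ∀ a i → σ a i ≤ V

update-bounded : ∀ {V σ} a i {v} → v ≤ V → Bounded V σ → Bounded V (update σ a i v)
update-bounded a i v≤ σ≤ b j with (a ≡ᵇ b) ∧ (i ≡ᵇ j)
... | true  = v≤
... | false = σ≤ b j

weaken : ∀ {V V′ σ} → V ≤ V′ → Bounded V σ → Bounded V′ σ
weaken V≤ σ≤ a i = ℕ.≤-trans (σ≤ a i) V≤

-- The command c halts within B steps in σ′, whose cells are at most V + B; here V
-- stands for a bound on the cells of σ.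
record Runs (W V B : ℕ) (c : Cmd) (σ σ′ : Store) : Set where
  constructor runs
  field
    {time}   : ℕ
    exec     : W ⊢ c , σ ⇓ σ′ , time
    in-time  : time ≤ B
    bounded  : Bounded (V + B) σ′

assignment : ∀ {W V B} σ a i e → eval σ e ≤ V + B → V + B ≤ W → 1 + cost i + cost e ≤ B →
  Bounded V σ → Runs W V B (a [ i ]≔ e) σ (update σ a (eval σ i) (eval σ e))
assignment {V = V} {B} σ a i e e≤ ≤W t≤ σ≤ =
  runs (assign (ℕ.≤-trans e≤ ≤W)) t≤
       (update-bounded a (eval σ i) e≤ (weaken (ℕ.m≤m+n V B) σ≤))

then-runs : ∀ {W V B B′ c d σ σ₁ σ₂} → Runs W V B c σ σ₁ → Runs W (V + B) B′ d σ₁ σ₂ →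
  Runs W V (B + B′) (c ⨟ d) σ σ₂
then-runs {V = V} {B} {B′} (runs e t _) (runs e′ t′ b′) =
  runs (seq e e′) (ℕ.+-mono-≤ t t′) (weaken (ℕ.≤-reflexive (ℕ.+-assoc V B B′)) b′)

≺-true : ∀ σ e f → eval σ e < eval σ f → eval σ (e ≺ f) ≢ 0
≺-true σ e f lt with eval σ e <ᵇ eval σ f | ℕ.<⇒<ᵇ lt
... | true | _ = λ ()

≺-false : ∀ σ e f → eval σ f ≤ eval σ e → eval σ (e ≺ f) ≡ 0
≺-false σ e f f≤e with eval σ e <ᵇ eval σ f | ℕ.<ᵇ⇒< (eval σ e) (eval σ f)
... | true  | lt = ⊥-elim (ℕ.<⇒≱ (lt _) f≤e)
... | false | _  = refl

-- Array 0 holds the loop limits N.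
Limits : (ℕ → ℕ) → Store → Set
Limits N σ = ∀ l → σ 0 l ≡ N l

limits-run : ∀ {N} p → writes p 0 ≡ false → ∀ {σ} → Limits N σ → Limits N (run p σ)
limits-run p e lim l = trans (frame p e _ l) (lim l)

limits-update : ∀ {N} r i v → (r ≡ᵇ 0) ≡ false → ∀ {σ} → Limits N σ → Limits N (update σ r i v)
limits-update r i v e {σ} lim l = trans (update-other σ r i v l e) (lim l)

-- The compiled program computes `run` within `bound` steps on words that can hold
-- V + bound, where V bounds the initial values.
adequate : ∀ N W p V σ → ok p ≡ true → writes p 0 ≡ false → Limits N σ → Bounded V σ →
  V + bound N p ≤ W → Runs W V (bound N p) (compile p) σ (run p σ)
adequate N W pass V σ _ _ lim σ≤ ≤W = runs skip ℕ.≤-refl (weaken (ℕ.m≤m+n V 1) σ≤)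
adequate N W (put a i c) V σ _ _ lim σ≤ ≤W =
  assignment σ a i (lit c)
    (ℕ.≤-trans (ℕ.m≤m+n c (1 + cost i + 1)) (ℕ.m≤n+m (c + (1 + cost i + 1)) V)) ≤W
    (ℕ.m≤n+m (1 + cost i + 1) c) σ≤
adequate N W (copy a i b j c) V σ _ _ lim σ≤ ≤W =
  assignment σ a i ((b [ j ]) ⊕ lit c)
    (ℕ.+-mono-≤ (σ≤ b (eval σ j)) (ℕ.m≤m+n c _)) ≤W (ℕ.m≤n+m _ c) σ≤
adequate N W (p then q) V σ okpq w lim σ≤ ≤W
  with ∧-true (ok p) okpq | ∨-false (writes p 0) w
... | okp , okq | wp , wq =
  let assoc = ℕ.+-assoc V (bound N p) (bound N q)
      first = adequate N W p V σ okp wp lim σ≤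
                (ℕ.≤-trans (ℕ.+-monoʳ-≤ V (ℕ.m≤m+n (bound N p) (bound N q))) ≤W)
  in then-runs first
       (adequate N W q (V + bound N p) (run p σ) okq wq (limits-run p wp lim)
         (Runs.bounded first) (ℕ.≤-trans (ℕ.≤-reflexive assoc) ≤W))
adequate N W (test e p q) V σ okpq w lim σ≤ ≤W
  with ∧-true (ok p) okpq | ∨-false (writes p 0) w
... | okp , okq | wp , wq =
  branch-elim (Runs W V B (ifte e (compile p) (compile q)) σ) (eval σ e)
    (λ e≢0 → let runs x t b = adequate N W p V σ okp wp lim σ≤ (ℕ.≤-trans (ℕ.+-monoʳ-≤ V p≤) ≤W) in
      runs (if-true e≢0 x) (ℕ.+-monoʳ-≤ (1 + cost e) (ℕ.≤-trans t (ℕ.m≤m+n (bound N p) (bound N q))))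
           (weaken (ℕ.+-monoʳ-≤ V p≤) b))
    (λ e≡0 → let runs x t b = adequate N W q V σ okq wq lim σ≤ (ℕ.≤-trans (ℕ.+-monoʳ-≤ V q≤) ≤W) in
      runs (if-false e≡0 x) (ℕ.+-monoʳ-≤ (1 + cost e) (ℕ.≤-trans t (ℕ.m≤n+m (bound N q) (bound N p))))
           (weaken (ℕ.+-monoʳ-≤ V q≤) b))
  where
  B = bound N (test e p q)
  p≤ : bound N p ≤ B
  p≤ = ℕ.≤-trans (ℕ.m≤m+n (bound N p) (bound N q)) (ℕ.m≤n+m _ (1 + cost e))
  q≤ : bound N q ≤ B
  q≤ = ℕ.≤-trans (ℕ.m≤n+m (bound N q) (bound N p)) (ℕ.m≤n+m _ (1 + cost e))
adequate N W (loop r l p) V σ okp w lim σ≤ ≤W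
  with ∧-true (not (writes p r)) okp | ∨-false (r ≡ᵇ 0) w
... | r∉p , okp′ | r≢0 , wp =
  then-runs {B = 3} {B′ = 6 + N l * D}
    (assignment σ r (lit 0) (lit 0) z≤n (ℕ.≤-trans (ℕ.+-monoʳ-≤ V (ℕ.m≤m+n 3 _)) ≤W) ℕ.≤-refl σ≤)
    (subst (λ k → Runs W (V + 3) (6 + N l * D) (while (guard r l) (compile p ⨟ incr r))
                    (update σ r 0 0) (iterate step k (update σ r 0 0))) (sym (lim l))
      (rounds (N l) 0 (V + 3) (update σ r 0 0) (update-same σ r 0 0) refl
        (limits-update r 0 0 r≢0 {σ} lim)
        (update-bounded r 0 z≤n (weaken (ℕ.m≤m+n V 3) σ≤))
        (ℕ.≤-trans (ℕ.≤-reflexive (ℕ.+-assoc V 3 (6 + N l * D))) ≤W)))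
  where
  B = bound N p
  D = 12 + B
  step = λ τ → bump r (run p τ)

  -- The remaining k rounds of the loop, from loop register i on.
  rounds : ∀ k i V τ → τ r 0 ≡ i → i + k ≡ N l → Limits N τ → Bounded V τ →
    V + (6 + k * D) ≤ W →
    Runs W V (6 + k * D) (while (guard r l) (compile p ⨟ incr r)) τ (iterate step k τ)
  rounds zero i V τ at-r i≡N lim τ≤ ≤W =
    runs (while-false (≺-false τ (r [ lit 0 ]) (0 [ lit l ])
           (ℕ.≤-reflexive (trans (lim l) (trans (sym i≡N) (trans (ℕ.+-identityʳ i) (sym at-r)))))))
         ℕ.≤-refl (weaken (ℕ.m≤m+n V 6) τ≤)
  rounds (suc k) i V τ at-r i≡N lim τ≤ ≤W = all
    where
    total : 6 + (D + k * D) ≡ D + (6 + k * D)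
    total = trans (sym (ℕ.+-assoc 6 D (k * D)))
              (trans (cong (_+ k * D) (ℕ.+-comm 6 D)) (ℕ.+-assoc D 6 (k * D)))
    V+D : V + D + (6 + k * D) ≡ V + (6 + (D + k * D))
    V+D = trans (ℕ.+-assoc V D (6 + k * D)) (cong (λ z → V + z) (sym total))
    V+B+6 : V + B + 6 ≤ V + D
    V+B+6 = ℕ.≤-trans (ℕ.≤-reflexive (ℕ.+-assoc V B 6))
              (ℕ.+-monoʳ-≤ V (ℕ.≤-trans (ℕ.≤-reflexive (ℕ.+-comm B 6)) (ℕ.m≤n+m (6 + B) 6)))
    V+D≤W : V + D ≤ W
    V+D≤W = ℕ.≤-trans (ℕ.m≤m+n (V + D) (6 + k * D)) (ℕ.≤-trans (ℕ.≤-reflexive V+D) ≤W)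
    r∉ = not-true r∉p
    body : Runs W V B (compile p) τ (run p τ)
    body = adequate N W p V τ okp′ wp lim τ≤
             (ℕ.≤-trans (ℕ.m≤m+n (V + B) 6) (ℕ.≤-trans V+B+6 V+D≤W))
    once : Runs W V (B + 6) (compile p ⨟ incr r) τ (step τ)
    once = then-runs body
      (assignment (run p τ) r (lit 0) ((r [ lit 0 ]) ⊕ lit 1)
        (ℕ.+-mono-≤ (Runs.bounded body r 0) (s≤s z≤n)) (ℕ.≤-trans V+B+6 V+D≤W) ℕ.≤-refl
        (Runs.bounded body))
    rest : Runs W (V + D) (6 + k * D) (while (guard r l) (compile p ⨟ incr r)) (step τ)
             (iterate step k (step τ))
    rest = rounds k (suc i) (V + D) (step τ)
      (trans (update-same (run p τ) r 0 _)
        (trans (cong (_+ 1) (trans (frame p r∉ τ 0) at-r)) (ℕ.+-comm i 1)))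
      (trans (sym (ℕ.+-suc i k)) i≡N)
      (limits-update r 0 _ r≢0 {run p τ} (limits-run p wp lim))
      (weaken (ℕ.≤-trans (ℕ.≤-reflexive (sym (ℕ.+-assoc V B 6))) V+B+6) (Runs.bounded once))
      (ℕ.≤-trans (ℕ.≤-reflexive V+D) ≤W)
    enter : eval τ (guard r l) ≢ 0
    enter = ≺-true τ (r [ lit 0 ]) (0 [ lit l ])
      (subst₂ _<_ (sym at-r) (trans i≡N (sym (lim l))) (ℕ.m<m+n i (s≤s z≤n)))
    all : Runs W V (6 + (D + k * D)) (while (guard r l) (compile p ⨟ incr r)) τ
            (iterate step k (step τ))
    all = runs (while-true enter (Runs.exec once) (Runs.exec rest))
      (ℕ.≤-trans (ℕ.+-mono-≤ (ℕ.+-monoʳ-≤ 6 (Runs.in-time once)) (Runs.in-time rest))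
        (ℕ.≤-trans (ℕ.≤-reflexive (cong (λ z → 6 + z + (6 + k * D)) (ℕ.+-comm B 6)))
          (ℕ.≤-reflexive (sym total))))
      (weaken (ℕ.≤-reflexive V+D) (Runs.bounded rest))

-- The program and its arrays; levels of a DAG

≺-reflects : ∀ σ e f → eval σ (e ≺ f) ≢ 0 → eval σ e < eval σ f
≺-reflects σ e f ≢0 with eval σ e <ᵇ eval σ f | ℕ.<ᵇ⇒< (eval σ e) (eval σ f)
... | true  | lt = lt _
... | false | _  = ⊥-elim (≢0 refl)

≺-refutes : ∀ σ e f → eval σ (e ≺ f) ≡ 0 → eval σ f ≤ eval σ e
≺-refutes σ e f ≡0 with eval σ e ℕ.<? eval σ f
... | yes lt = ⊥-elim (≺-true σ e f lt ≡0)
... | no ≮   = ℕ.≮⇒≥ ≮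

if-elim : {A : Set} (P : A → Set) (i j : ℕ) {v w : A} →
  (i ≡ j → P v) → (i ≢ j → P w) → P (if i ≡ᵇ j then v else w)
if-elim P i j f g with i ≡ᵇ j | ℕ.≡ᵇ⇒≡ i j | ℕ.≡⇒≡ᵇ i j
... | true  | eq | _  = f (eq _)
... | false | _  | ne = g ne

test-elim : (P : Store → Set) → ∀ e p q σ → (eval σ e ≢ 0 → P (run p σ)) →
  (eval σ e ≡ 0 → P (run q σ)) → P (run (test e p q) σ)
test-elim P e p q σ = branch-elim P (eval σ e)

reg : Name → Expr
reg r = r [ lit 0 ]

-- Input: dims = n, m, k; arcs; pairs.  `level` is the level of each vertex;
-- `sortedTails` and `sortedHeads` hold the arcs by level of the head, the first
-- `filled` places being in use; `label` is the n × n matrix of the labels, the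
-- row of s belonging to the source s.
dims tails heads firstOf secondOf output level sortedTails sortedHeads filled label : Name
dims = 0
tails = 1
heads = 2
firstOf = 3
secondOf = 4
output = 5
level = 6
sortedTails = 7
sortedHeads = 8
filled = 9
label = 10

i₁ i₂ i₃ flag : Name
i₁ = 11
i₂ = 12
i₃ = 13
flag = 14

-- Relaxation of one arc: the level of its head becomes at least 1 more than that
-- of its tail.
raise : Prog
raise = test ((level [ tails [ reg i₂ ] ]) ≺ (level [ heads [ reg i₂ ] ]))
          pass
          (copy level (heads [ reg i₂ ]) level (tails [ reg i₂ ]) 1)

findLevels : Prog
findLevels = loop i₁ 0 (loop i₂ 1 raise)

-- The effect of `raise` on the levels d, for an arc with tail t and head h.
record Raised (t h : ℕ) (d d′ : ℕ → ℕ) : Set where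
  field
    grows  : ∀ x → d x ≤ d′ x
    above  : suc (d t) ≤ d′ h
    change : ∀ x → d′ x ≡ d x ⊎ (x ≡ h × d′ x ≡ suc (d t))

raise-raises : ∀ τ → let e = τ i₂ 0 in Raised (τ tails e) (τ heads e) (τ level) (run raise τ level)
raise-raises τ = test-elim (λ τ′ → Raised t h (τ level) (τ′ level))
  (E ≺ F) pass (copy level (heads [ reg i₂ ]) level (tails [ reg i₂ ]) 1) τ
  (λ ≢0 → record { grows = λ x → ℕ.≤-refl ; above = ≺-reflects τ E F ≢0 ; change = λ x → inj₁ refl })
  (λ ≡0 → record
    { grows  = λ x → if-elim (τ level x ≤_) h x
                 (λ { refl → ℕ.≤-trans (≺-refutes τ E F ≡0) (ℕ.m≤m+n _ 1) }) (λ _ → ℕ.≤-refl)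
    ; above  = if-elim (suc (τ level t) ≤_) h h
                 (λ _ → ℕ.≤-reflexive (ℕ.+-comm 1 _)) (λ h≢h → ⊥-elim (h≢h refl))
    ; change = λ x → if-elim (λ v → v ≡ τ level x ⊎ (x ≡ h × v ≡ suc (τ level t))) h x
                 (λ h≡x → inj₂ (sym h≡x , ℕ.+-comm _ 1)) (λ _ → inj₁ refl) })
  where
  e = τ i₂ 0
  t = τ tails e
  h = τ heads e
  E = level [ tails [ reg i₂ ] ]
  F = level [ heads [ reg i₂ ] ]

module _ (G : DAG) where
  open DAG G

  -- The arrays tl and hd hold the arc (u , v) in place e.
  ArcAt : (ℕ → ℕ) → (ℕ → ℕ) → ℕ → Vertex → Vertex → Set
  ArcAt tl hd e u v = tl e ≡ toℕ u × hd e ≡ toℕ v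

  -- The first m entries of tl and hd are the arcs of G, in any order.
  record Enumerates (tl hd : ℕ → ℕ) : Set where
    field
      arc-at   : ∀ e → e < m → Σ[ u ∈ Vertex ] Σ[ v ∈ Vertex ] (Arc u v × ArcAt tl hd e u v)
      index-of : ∀ {u v} → Arc u v → ∃[ e ] (e < m × ArcAt tl hd e u v)

  -- All that is used of levels: they increase along arcs and are smaller than n.
  record IsLevel (d : ℕ → ℕ) : Set where
    field
      ascends : ∀ {u v} → Arc u v → d (toℕ u) < d (toℕ v)
      below-n : ∀ (v : Vertex) → d (toℕ v) < n

  -- A path with the given number of arcs ending in the given vertex.
  data Walk : ℕ → Vertex → Set where
    start : ∀ {v} → Walk 0 v
    _∷ʳ_  : ∀ {ℓ u v} → Walk ℓ u → Arc u v → Walk (suc ℓ) v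

  -- The vertices of a walk, counted backwards from its end.
  walk-vertex : ∀ {ℓ v} → Walk ℓ v → Fin (suc ℓ) → Vertex
  walk-vertex {v = v} w        Fin.zero    = v
  walk-vertex         (w ∷ʳ a) (Fin.suc i) = walk-vertex w i

  walk-to-end : ∀ {ℓ v} (w : Walk ℓ v) (i : Fin ℓ) → TransClosure Arc (walk-vertex w (Fin.suc i)) v
  walk-to-end (start ∷ʳ a)     Fin.zero    = Plus.[ a ]
  walk-to-end ((w ∷ʳ b) ∷ʳ a)  Fin.zero    = Plus.[ a ]
  walk-to-end (w ∷ʳ a)         (Fin.suc i) = walk-to-end w i Plus.∷ʳ a

  walk-backwards : ∀ {ℓ v} (w : Walk ℓ v) (i j : Fin (suc ℓ)) → i Fin.< j →
    TransClosure Arc (walk-vertex w j) (walk-vertex w i)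
  walk-backwards w        Fin.zero    (Fin.suc j) _         = walk-to-end w j
  walk-backwards (w ∷ʳ a) (Fin.suc i) (Fin.suc j) (s≤s i<j) = walk-backwards w i j i<j

  -- A walk with n or more arcs visits some vertex twice, contrary to acyclicity.
  walk-short : ∀ {ℓ v} → Walk ℓ v → ℓ < n
  walk-short {ℓ} w with ℓ ℕ.<? n
  ... | yes lt = lt
  ... | no ≮   with pigeonhole (s≤s (ℕ.≮⇒≥ ≮)) (walk-vertex w)
  ...   | i , j , i<j , same =
    ⊥-elim (acyclic _ (subst (TransClosure Arc _) same (walk-backwards w i j i<j)))

  module _ {tl hd : ℕ → ℕ} (enum : Enumerates tl hd) where
    open Enumerates enum

    -- After r complete rounds and e arcs of the next: every level is the length of a
    -- walk, and no walk with at most r arcs is longer than the level of its end, nor is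
    -- such a walk prolonged by one of the e arcs.
    record Round (r e : ℕ) (d : ℕ → ℕ) : Set where
      field
        attained : ∀ v → Walk (d (toℕ v)) v
        long     : ∀ {ℓ v} → ℓ ≤ r → Walk ℓ v → ℓ ≤ d (toℕ v)
        treated  : ∀ {e′ u v ℓ} → e′ < e → ArcAt tl hd e′ u v → ℓ ≤ r → Walk ℓ u →
                   suc ℓ ≤ d (toℕ v)

    round-zero : ∀ {d} → (∀ x → d x ≡ 0) → Round 0 0 d
    round-zero d≡0 = record
      { attained = λ v → subst (λ ℓ → Walk ℓ v) (sym (d≡0 (toℕ v))) start
      ; long     = λ ℓ≤0 _ → ℕ.≤-trans ℓ≤0 z≤n
      ; treated  = λ ()
      }

    round-step : ∀ {r e d d′} → e < m → Raised (tl e) (hd e) d d′ → Round r e d → Round r (suc e) d′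
    round-step {r} {e} {d} {d′} e<m R inv = record
      { attained = attained′
      ; long     = λ ℓ≤r w → ℕ.≤-trans (long ℓ≤r w) (grows _)
      ; treated  = treated′
      }
      where
      open Round inv
      open Raised R
      attained′ : ∀ v → Walk (d′ (toℕ v)) v
      attained′ v with change (toℕ v) | arc-at e e<m
      ... | inj₁ same     | _ = subst (λ ℓ → Walk ℓ v) (sym same) (attained v)
      ... | inj₂ (v≡h , d′≡) | u , w , a , t≡u , h≡w with toℕ-injective (trans v≡h h≡w)
      ...   | refl = subst (λ ℓ → Walk ℓ v) (sym (trans d′≡ (cong (λ z → suc (d z)) t≡u)))
                       (attained u ∷ʳ a)
      treated′ : ∀ {e′ u v ℓ} → e′ < suc e → ArcAt tl hd e′ u v → ℓ ≤ r → Walk ℓ u →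
                 suc ℓ ≤ d′ (toℕ v)
      treated′ {e′} (s≤s e′≤e) at ℓ≤r w with e′ ℕ.≟ e
      ... | no e′≢e = ℕ.≤-trans (treated (ℕ.≤∧≢⇒< e′≤e e′≢e) at ℓ≤r w) (grows _)
      ... | yes refl = ℕ.≤-trans (s≤s (long ℓ≤r w))
              (subst₂ (λ x y → suc (d x) ≤ d′ y) (proj₁ at) (proj₂ at) above)

    round-finish : ∀ {r d} → Round r m d → Round (suc r) 0 d
    round-finish {r} {d} inv = record { attained = attained ; long = long′ ; treated = λ () }
      where
      open Round inv
      long′ : ∀ {ℓ v} → ℓ ≤ suc r → Walk ℓ v → ℓ ≤ d (toℕ v)
      long′ _ start = z≤n
      long′ (s≤s ℓ≤r) (w ∷ʳ a) with index-of a
      ... | e , e<m , at = treated e<m at ℓ≤r w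

    -- Levels being lengths of walks, they are smaller than n, so n rounds have
    -- accounted for every walk.
    rounds-level : ∀ {d} → Round n 0 d → IsLevel d
    rounds-level inv = record
      { ascends = λ {u} a → long (walk-short (attained u)) (attained u ∷ʳ a)
      ; below-n = λ v → walk-short (attained v)
      }
      where open Round inv

  findLevels-correct : ∀ σ → σ dims 0 ≡ n → σ dims 1 ≡ m → Enumerates (σ tails) (σ heads) →
    (∀ x → σ level x ≡ 0) → IsLevel (run findLevels σ level)
  findLevels-correct σ n≡ m≡ enum zeros =
    rounds-level enum (subst (λ r → Round enum r 0 _) n≡
      (loop-rule i₁ 0 (loop i₂ 1 raise) σ (λ r τ → Round enum r 0 (τ level)) refl
        (round-zero enum zeros)
        λ r τ _ _ same inv → round-finish enum
          (subst (λ e → Round enum r e _) (trans (same dims 1 refl) m≡)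
            (loop-rule i₂ 1 raise τ (λ e υ → Round enum r e (υ level)) refl
              inv
              λ { e υ e< refl same′ inv′ → round-step enum
                    (subst (e <_) (trans (same dims 1 refl) m≡) e<)
                    (subst₂ (λ t h → Raised t h (υ level) (run raise υ level))
                      (trans (same′ tails e refl) (same tails e refl))
                      (trans (same′ heads e refl) (same heads e refl))
                      (raise-raises υ))
                    inv′ }))))

-- Sorting the arcs by level

-- Nonzero iff the two values are different.
differ : Expr → Expr → Expr
differ e f = (e ≺ f) ⊕ (f ≺ e)

differ-reflects : ∀ σ e f → eval σ (differ e f) ≢ 0 → eval σ e ≢ eval σ f
differ-reflects σ e f ≢0 e≡f =
  ≢0 (cong₂ _+_ (≺-false σ e f (ℕ.≤-reflexive (sym e≡f))) (≺-false σ f e (ℕ.≤-reflexive e≡f)))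

differ-refutes : ∀ σ e f → eval σ (differ e f) ≡ 0 → eval σ e ≡ eval σ f
differ-refutes σ e f ≡0 = ℕ.≤-antisym
  (≺-refutes σ f e (ℕ.m+n≡0⇒n≡0 (eval σ (e ≺ f)) ≡0))
  (≺-refutes σ e f (ℕ.m+n≡0⇒m≡0 (eval σ (e ≺ f)) ≡0))

module _ (κ : ℕ → ℕ) where

  -- Number of e < N with κ e ≡ ℓ.
  #at : ℕ → ℕ → ℕ
  #at ℓ zero    = 0
  #at ℓ (suc N) = if κ N ≡ᵇ ℓ then suc (#at ℓ N) else #at ℓ N

  -- Number of e < N with κ e < ℓ.
  #below : ℕ → ℕ → ℕ
  #below zero    N = 0
  #below (suc ℓ) N = #below ℓ N + #at ℓ N

  #at-hit : ∀ {ℓ N} → κ N ≡ ℓ → #at ℓ (suc N) ≡ suc (#at ℓ N)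
  #at-hit {ℓ} {N} e = if-elim (_≡ suc (#at ℓ N)) (κ N) ℓ (λ _ → refl) (λ ne → ⊥-elim (ne e))

  #at-miss : ∀ {ℓ N} → κ N ≢ ℓ → #at ℓ (suc N) ≡ #at ℓ N
  #at-miss {ℓ} {N} ne = if-elim (_≡ #at ℓ N) (κ N) ℓ (λ e → ⊥-elim (ne e)) (λ _ → refl)

  #below-miss : ∀ L {N} → L ≤ κ N → #below L (suc N) ≡ #below L N
  #below-miss zero    L≤κ = refl
  #below-miss (suc L) L<κ =
    cong₂ _+_ (#below-miss L (ℕ.<⇒≤ L<κ)) (#at-miss (λ e → ℕ.<⇒≢ L<κ (sym e)))

  #below-hit : ∀ L {N} → κ N < L → #below L (suc N) ≡ suc (#below L N)
  #below-hit (suc L) {N} (s≤s κ≤L) with κ N ℕ.≟ L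
  ... | yes e = trans (cong₂ _+_ (#below-miss L (ℕ.≤-reflexive (sym e))) (#at-hit e))
                      (ℕ.+-suc (#below L N) (#at L N))
  ... | no ne = cong₂ _+_ (#below-hit L (ℕ.≤∧≢⇒< κ≤L ne)) (#at-miss ne)

  #below-all : ∀ L N → (∀ e → e < N → κ e < L) → #below L N ≡ N
  #below-all zero    zero    _   = refl
  #below-all (suc L) zero    _   = trans (ℕ.+-identityʳ _) (#below-all L zero λ _ ())
  #below-all L       (suc N) all = trans (#below-hit L (all N ℕ.≤-refl))
    (cong suc (#below-all L N λ e e<N → all e (ℕ.m<n⇒m<1+n e<N)))

append : Prog
append = copy sortedTails (reg filled) tails (reg i₂) 0 then
         copy sortedHeads (reg filled) heads (reg i₂) 0 then
         copy filled (lit 0) filled (lit 0) 1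

-- Appends the current arc if its head has the current level.
appendIfLevel : Prog
appendIfLevel = test (differ (level [ heads [ reg i₂ ] ]) (reg i₁)) pass append

sortArcs : Prog
sortArcs = loop i₁ 0 (loop i₂ 1 appendIfLevel)

module _ (G : DAG) where
  open DAG G

  -- tl and hd hold the arcs of G by increasing level of the head.
  record Sorted (d tl hd : ℕ → ℕ) : Set where
    field
      enumerates : Enumerates G tl hd
      monotone   : ∀ {i j} → i ≤ j → j < m → d (hd i) ≤ d (hd j)

  module _ {d tl hd : ℕ → ℕ} (enum : Enumerates G tl hd) (isLevel : IsLevel G d) where
    open Enumerates enum
    open IsLevel isLevel

    -- The sorting key of the arc in place e.
    κ : ℕ → ℕ
    κ e = d (hd e)

    -- When all arcs with keys below ℓ and those among the first e arcs with key ℓ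
    -- have been appended, c places are in use.  `size` shows in the end that all m
    -- places are filled exactly once.
    record Sorting (ℓ e c : ℕ) (tl′ hd′ : ℕ → ℕ) : Set where
      field
        size     : c ≡ #below κ ℓ m + #at κ ℓ e
        origin   : ∀ {i} → i < c → ∃[ e′ ] (e′ < m × tl′ i ≡ tl e′ × hd′ i ≡ hd e′)
        capped   : ∀ {i} → i < c → d (hd′ i) ≤ ℓ
        ordered  : ∀ {i j} → i ≤ j → j < c → d (hd′ i) ≤ d (hd′ j)
        included : ∀ {e′} → e′ < m → κ e′ < ℓ ⊎ (κ e′ ≡ ℓ × e′ < e) →
                   ∃[ i ] (i < c × tl′ i ≡ tl e′ × hd′ i ≡ hd e′)

    sorting-start : ∀ {tl′ hd′} → Sorting 0 0 0 tl′ hd′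
    sorting-start = record
      { size = refl ; origin = λ () ; capped = λ () ; ordered = λ _ ()
      ; included = λ { _ (inj₁ ()) ; _ (inj₂ (_ , ())) } }

    sorting-skip : ∀ {ℓ e c tl′ hd′} → κ e ≢ ℓ → Sorting ℓ e c tl′ hd′ → Sorting ℓ (suc e) c tl′ hd′
    sorting-skip {ℓ} {e} ne S = record
      { size = trans size (cong (λ z → #below κ ℓ m + z) (sym (#at-miss κ ne)))
      ; origin = origin ; capped = capped ; ordered = ordered
      ; included = λ { e′<m (inj₁ lt) → included e′<m (inj₁ lt)
                     ; e′<m (inj₂ (eq , s≤s e′≤e)) → included e′<m
                         (inj₂ (eq , ℕ.≤∧≢⇒< e′≤e λ { refl → ne eq })) } }
      where open Sorting S

    sorting-append : ∀ {ℓ e c tl′ hd′ c″ tl″ hd″} → e < m → κ e ≡ ℓ →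
      c″ ≡ suc c → tl″ c ≡ tl e → hd″ c ≡ hd e →
      (∀ {i} → i < c → tl″ i ≡ tl′ i × hd″ i ≡ hd′ i) →
      Sorting ℓ e c tl′ hd′ → Sorting ℓ (suc e) c″ tl″ hd″
    sorting-append {ℓ} {e} {c} {tl′} {hd′} {_} {tl″} {hd″} e<m κ≡ℓ refl t≡ h≡ old S = record
      { size = trans (cong suc size) (trans (sym (ℕ.+-suc (#below κ ℓ m) (#at κ ℓ e)))
                 (cong (λ z → #below κ ℓ m + z) (sym (#at-hit κ κ≡ℓ))))
      ; origin = origin′ ; capped = capped′ ; ordered = ordered′ ; included = included′ }
      where
      open Sorting S
      top : d (hd″ c) ≡ ℓ
      top = trans (cong d h≡) κ≡ℓ
      origin′ : ∀ {i} → i < suc c → ∃[ e′ ] (e′ < m × tl″ i ≡ tl e′ × hd″ i ≡ hd e′)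
      origin′ {i} (s≤s i≤c) with i ℕ.≟ c
      ... | yes refl = e , e<m , t≡ , h≡
      ... | no ne with ℕ.≤∧≢⇒< i≤c ne
      ...   | i<c = let e′ , e′< , t , h = origin i<c in
                    e′ , e′< , trans (proj₁ (old i<c)) t , trans (proj₂ (old i<c)) h
      capped′ : ∀ {i} → i < suc c → d (hd″ i) ≤ ℓ
      capped′ {i} (s≤s i≤c) with i ℕ.≟ c
      ... | yes refl = ℕ.≤-reflexive top
      ... | no ne with ℕ.≤∧≢⇒< i≤c ne
      ...   | i<c = subst (λ x → d x ≤ ℓ) (sym (proj₂ (old i<c))) (capped i<c)
      ordered′ : ∀ {i j} → i ≤ j → j < suc c → d (hd″ i) ≤ d (hd″ j)
      ordered′ {i} {j} i≤j (s≤s j≤c) with j ℕ.≟ c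
      ... | yes refl = subst (d (hd″ i) ≤_) (sym top) (capped′ (s≤s i≤j))
      ... | no ne with ℕ.≤∧≢⇒< j≤c ne
      ...   | j<c = subst₂ (λ x y → d x ≤ d y) (sym (proj₂ (old (ℕ.≤-<-trans i≤j j<c))))
                      (sym (proj₂ (old j<c))) (ordered i≤j j<c)
      keep : ∀ {e′} → ∃[ i ] (i < c × tl′ i ≡ tl e′ × hd′ i ≡ hd e′) →
             ∃[ i ] (i < suc c × tl″ i ≡ tl e′ × hd″ i ≡ hd e′)
      keep (i , i<c , t , h) =
        i , ℕ.m<n⇒m<1+n i<c , trans (proj₁ (old i<c)) t , trans (proj₂ (old i<c)) h
      included′ : ∀ {e′} → e′ < m → κ e′ < ℓ ⊎ (κ e′ ≡ ℓ × e′ < suc e) →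
                  ∃[ i ] (i < suc c × tl″ i ≡ tl e′ × hd″ i ≡ hd e′)
      included′ e′<m (inj₁ lt) = keep (included e′<m (inj₁ lt))
      included′ {e′} e′<m (inj₂ (eq , s≤s e′≤e)) with e′ ℕ.≟ e
      ... | yes refl = c , ℕ.≤-refl , t≡ , h≡
      ... | no ne    = keep (included e′<m (inj₂ (eq , ℕ.≤∧≢⇒< e′≤e ne)))

    sorting-finish : ∀ {ℓ c tl′ hd′} → Sorting ℓ m c tl′ hd′ → Sorting (suc ℓ) 0 c tl′ hd′
    sorting-finish {ℓ} S = record
      { size = trans size (sym (ℕ.+-identityʳ _)) ; origin = origin
      ; capped = λ i<c → ℕ.m≤n⇒m≤1+n (capped i<c) ; ordered = ordered ; included = included′ }
      where
      open Sorting S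
      included′ : ∀ {e′} → e′ < m → κ e′ < suc ℓ ⊎ (κ e′ ≡ suc ℓ × e′ < 0) → _
      included′ {e′} e′<m (inj₁ (s≤s κ≤ℓ)) with κ e′ ℕ.≟ ℓ
      ... | yes eq = included e′<m (inj₂ (eq , e′<m))
      ... | no ne  = included e′<m (inj₁ (ℕ.≤∧≢⇒< κ≤ℓ ne))

    κ<n : ∀ {e} → e < m → κ e < n
    κ<n e<m with arc-at _ e<m
    ... | u , v , _ , _ , h = subst (λ x → d x < n) (sym h) (below-n v)

    sorting-sorted : ∀ {c tl′ hd′} → Sorting n 0 c tl′ hd′ → Sorted d tl′ hd′
    sorting-sorted {c} {tl′} {hd′} S = record
      { enumerates = record
        { arc-at = λ i i<m →
            let e , e<m , t , h = origin (in-range i<m)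
                u , v , a , t′ , h′ = arc-at e e<m
            in u , v , a , trans t t′ , trans h h′
        ; index-of = λ a →
            let e , e<m , t , h = index-of a
                i , i<c , t′ , h′ = included e<m (inj₁ (κ<n e<m))
            in i , subst (i <_) c≡m i<c , trans t′ t , trans h′ h }
      ; monotone = λ i≤j j<m → ordered i≤j (in-range j<m) }
      where
      open Sorting S
      c≡m : c ≡ m
      c≡m = trans size (trans (ℕ.+-identityʳ _) (#below-all κ n m λ _ → κ<n))
      in-range : ∀ {i} → i < m → i < c
      in-range {i} = subst (i <_) (sym c≡m)

  sortArcs-correct : ∀ σ → σ dims 0 ≡ n → σ dims 1 ≡ m → Enumerates G (σ tails) (σ heads) →
    IsLevel G (σ level) → σ filled 0 ≡ 0 →
    Sorted (σ level) (run sortArcs σ sortedTails) (run sortArcs σ sortedHeads)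
  sortArcs-correct σ n≡ m≡ enum isLevel empty =
    sorting-sorted enum isLevel (subst (λ ℓ → At ℓ 0 (run sortArcs σ)) n≡
      (loop-rule i₁ 0 (loop i₂ 1 appendIfLevel) σ (λ ℓ τ → At ℓ 0 τ) refl
        (subst (λ c → Sorting enum isLevel 0 0 c (σ sortedTails) (σ sortedHeads)) (sym empty) (sorting-start enum isLevel))
        λ { ℓ τ _ refl same inv → sorting-finish enum isLevel
          (subst (λ e → At ℓ e (run (loop i₂ 1 appendIfLevel) τ)) (trans (same dims 1 refl) m≡)
            (loop-rule i₂ 1 appendIfLevel τ (λ e υ → At ℓ e υ) refl
              inv
              λ { e υ e< refl same′ inv′ →
                body υ (subst (e <_) (trans (same dims 1 refl) m≡) e<) (same′ i₁ 0 refl)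
                  (λ x → trans (same′ tails x refl) (same tails x refl))
                  (λ x → trans (same′ heads x refl) (same heads x refl))
                  (λ x → trans (same′ level x refl) (same level x refl)) inv′ })) }))
    where
    At : ℕ → ℕ → Store → Set
    At ℓ e τ = Sorting enum isLevel ℓ e (τ filled 0) (τ sortedTails) (τ sortedHeads)

    body : ∀ υ {ℓ} → υ i₂ 0 < m → υ i₁ 0 ≡ ℓ → (∀ x → υ tails x ≡ σ tails x) →
      (∀ x → υ heads x ≡ σ heads x) → (∀ x → υ level x ≡ σ level x) →
      At ℓ (υ i₂ 0) υ → At ℓ (suc (υ i₂ 0)) (run appendIfLevel υ)
    body υ {ℓ} e<m ℓ≡ tl≡ hd≡ d≡ inv =
      test-elim (At ℓ (suc e)) (differ X (reg i₁)) pass append υ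
        (λ ≢0 → sorting-skip enum isLevel
          (λ κ≡ → differ-reflects υ X (reg i₁) ≢0 (trans key (trans κ≡ (sym ℓ≡)))) inv)
        (λ ≡0 → sorting-append enum isLevel e<m
          (trans (sym key) (trans (differ-refutes υ X (reg i₁) ≡0) ℓ≡))
          (ℕ.+-comm c 1)
          (trans (update-same υ sortedTails c _) (trans (ℕ.+-identityʳ _) (tl≡ e)))
          (trans (update-same υ sortedHeads c _) (trans (ℕ.+-identityʳ _) (hd≡ e)))
          (λ {i} i<c → if-elim (_≡ υ sortedTails i) c i (λ { refl → ⊥-elim (ℕ.<-irrefl refl i<c) }) (λ _ → refl)
                     , if-elim (_≡ υ sortedHeads i) c i (λ { refl → ⊥-elim (ℕ.<-irrefl refl i<c) }) (λ _ → refl))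
          inv)
      where
      e = υ i₂ 0
      c = υ filled 0
      X = level [ heads [ reg i₂ ] ]
      key : eval υ X ≡ σ level (σ heads e)
      key = trans (cong (υ level) (hd≡ e)) (d≡ (σ heads e))

-- Computing the labels of all sources

-- Place of the entry (i , j) of a k × n matrix stored row by row.
index : ∀ {k n} → Fin k → Fin n → ℕ
index {n = n} i j = toℕ i * n + toℕ j

index-injective : ∀ {k n} {i i′ : Fin k} {j j′ : Fin n} →
  index i j ≡ index i′ j′ → i ≡ i′ × j ≡ j′
index-injective {n = n} {i} {i′} {j} {j′} e =
  combine-injective i j i′ j′ (toℕ-injective (trans (as-index i j) (trans e (sym (as-index i′ j′)))))
  where
  as-index : ∀ i j → toℕ (combine i j) ≡ index i j
  as-index i j = trans (toℕ-combine i j) (cong (_+ toℕ j) (ℕ.*-comm n (toℕ i)))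

cell : Expr → Expr → Expr
cell e f = (e ⊗ (dims [ lit 0 ])) ⊕ f

eval-cell : ∀ {k n} τ e f {i : Fin k} {j : Fin n} → τ dims 0 ≡ n → eval τ e ≡ toℕ i →
  eval τ f ≡ toℕ j → eval τ (cell e f) ≡ index i j
eval-cell τ e f n≡ i≡ j≡ = cong₂ _+_ (cong₂ _*_ i≡ n≡) j≡

row : ∀ {k n} → (ℕ → ℕ) → Fin k → Fin n → ℕ
row f i j = f (index i j)

tailCell headCell : Expr
tailCell = cell (reg i₁) (sortedTails [ reg i₂ ])
headCell = cell (reg i₁) (sortedHeads [ reg i₂ ])

-- `relaxLabel` performs the update described by `Relaxed` for the source in i₁ and
-- the sorted arc number i₂: `inherit` copies the label of the tail, `meet` makes
-- the head its own label.
inherit meet relaxFirst relaxReached relaxLabel startLabel labelFrom labelAll : Prog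
inherit      = copy label headCell label tailCell 0
meet         = copy label headCell sortedHeads (reg i₂) 1
relaxFirst   = test (differ (sortedTails [ reg i₂ ]) (reg i₁)) inherit meet
relaxReached = test (differ (label [ headCell ]) (label [ tailCell ]))
                 (test (label [ headCell ]) meet relaxFirst)
                 pass
relaxLabel   = test (label [ tailCell ]) relaxReached pass
startLabel   = copy label (cell (reg i₁) (reg i₁)) i₁ (lit 0) 1
labelFrom    = startLabel then loop i₂ 1 relaxLabel
labelAll     = loop i₁ 0 labelFrom

-- The matrix f′ results from f by relaxing the arc (p , x) for the source s.
record Step {n : ℕ} (s p x : Fin n) (f f′ : ℕ → ℕ) : Set where
  field
    relaxed : Relaxed s p x (row f s p) (row f s x) (row f′ s x)
    others  : ∀ y → y ≢ index s x → f′ y ≡ f y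

relaxLabel-step : ∀ {n} τ {s p x : Fin n} → τ dims 0 ≡ n → τ i₁ 0 ≡ toℕ s →
  τ sortedTails (τ i₂ 0) ≡ toℕ p → τ sortedHeads (τ i₂ 0) ≡ toℕ x →
  Step s p x (τ label) (run relaxLabel τ label)
relaxLabel-step τ {s} {p} {x} n≡ s≡ p≡ x≡ =
  test-elim Goal (label [ tailCell ]) relaxReached pass τ
    (λ a≢0 → let a≢0 = nonzero-p a≢0 in
      test-elim Goal (differ H T) (test H meet relaxFirst) pass τ
        (λ h≢t → let b≢a = λ e → differ-reflects τ H T h≢t (trans at-x (trans e (sym at-p))) in
          test-elim Goal H meet relaxFirst τ
            (λ b≢0 → meeting-step a≢0 b≢a (inj₂ λ e → b≢0 (trans at-x e)))
            (λ b≡0 → test-elim Goal (differ P (reg i₁)) inherit meet τ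
              (λ p≢s → write (τ label (eval τ tailCell) + 0)
                (subst (Relaxed s p x a b) (trans (sym at-p) (sym (ℕ.+-identityʳ _)))
                  (first a≢0 (trans (sym at-x) b≡0)
                    (λ e → differ-reflects τ P (reg i₁) p≢s (trans p≡ (trans (cong toℕ e) (sym s≡)))))))
              (λ p≡s → meeting-step a≢0 b≢a (inj₁ (toℕ-injective
                (trans (sym p≡) (trans (differ-refutes τ P (reg i₁) p≡s) s≡)))))))
        (λ h≡t → keep (agreeing a≢0 (trans (sym at-x) (trans (differ-refutes τ H T h≡t) at-p)))))
    (λ a≡0 → keep (unreached (trans (sym at-p) a≡0)))
  where
  H = label [ headCell ]
  T = label [ tailCell ]
  P = sortedTails [ reg i₂ ]
  a = row (τ label) s p
  b = row (τ label) s x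
  Goal : Store → Set
  Goal τ′ = Step s p x (τ label) (τ′ label)
  ix : eval τ headCell ≡ index s x
  ix = eval-cell τ (reg i₁) (sortedHeads [ reg i₂ ]) n≡ s≡ x≡
  at-p : eval τ T ≡ a
  at-p = cong (τ label) (eval-cell τ (reg i₁) (sortedTails [ reg i₂ ]) n≡ s≡ p≡)
  at-x : eval τ H ≡ b
  at-x = cong (τ label) ix
  nonzero-p : eval τ T ≢ 0 → a ≢ 0
  nonzero-p ≢0 e = ≢0 (trans at-p e)
  keep : Relaxed s p x a b b → Goal τ
  keep r = record { relaxed = r ; others = λ _ _ → refl }
  write : ∀ v → Relaxed s p x a b v → Goal (update τ label (eval τ headCell) v)
  write v r = record
    { relaxed = subst (Relaxed s p x a b)
        (trans (sym (update-same τ label _ v)) (cong (update τ label (eval τ headCell) v label) ix)) r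
    ; others  = λ y y≢ → if-elim (_≡ τ label y) (eval τ headCell) y
        (λ e → ⊥-elim (y≢ (trans (sym e) ix))) (λ _ → refl) }
  meeting-step : a ≢ 0 → b ≢ a → p ≡ s ⊎ b ≢ 0 → Goal (run meet τ)
  meeting-step a≢0 b≢a why = write (τ sortedHeads (τ i₂ 0) + 1)
    (subst (Relaxed s p x a b) (trans (cong suc (sym x≡)) (ℕ.+-comm 1 _)) (meeting a≢0 b≢a why))

module _ (G : DAG) where
  open DAG G

  -- The arcs in the first i places.
  Before : (tl hd : ℕ → ℕ) → ℕ → Vertex → Vertex → Set
  Before tl hd i u v = ∃[ j ] (j < i × ArcAt G tl hd j u v)

  module _ {d tl hd : ℕ → ℕ} (isLevel : IsLevel G d) (sorted : Sorted G d tl hd) where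
    open IsLevel isLevel
    open Sorted sorted
    open Enumerates enumerates

    arc : ∀ {i u v} → i < m → ArcAt G tl hd i u v → Arc u v
    arc i<m (t , h) with arc-at _ i<m
    ... | u′ , v′ , a , t′ , h′ =
      subst₂ Arc (toℕ-injective (trans (sym t′) t)) (toℕ-injective (trans (sym h′) h)) a

    path-ascends : ∀ {i u v} → i ≤ m → Star (Before tl hd i) u v → d (toℕ u) ≤ d (toℕ v)
    path-ascends i≤m ε = ℕ.≤-refl
    path-ascends i≤m ((j , j<i , at) ◅ P) =
      ℕ.≤-trans (ℕ.<⇒≤ (ascends (arc (ℕ.<-≤-trans j<i i≤m) at))) (path-ascends i≤m P)

    labelling-step : ∀ {i s p x f f′} → i < m → ArcAt G tl hd i p x → Step s p x f f′ →
      Labelling (Before tl hd i) s (row f s) → Labelling (Before tl hd (suc i)) s (row f′ s)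
    labelling-step {i} {s} {p} {x} {f} {f′} i<m at S L =
      AddArc.relax-labelling
        (λ (j , j<i , at′) → j , ℕ.m<n⇒m<1+n j<i , at′) (i , ℕ.≤-refl , at) only sink p≢x L
        (λ p≢0 x≡s → ℕ.<⇒≱ p<x (subst (λ y → d (toℕ y) ≤ d (toℕ p)) (sym x≡s)
                       (path-ascends (ℕ.<⇒≤ i<m) (Labelling.sound L p p≢0))))
        (λ y y≢x → Step.others S _ (λ e → y≢x (proj₂ (index-injective {i = s} {s} e))))
        (Step.relaxed S)
      where
      p<x : d (toℕ p) < d (toℕ x)
      p<x = ascends (arc i<m at)
      only : ∀ {a b} → Before tl hd (suc i) a b → Before tl hd i a b ⊎ (a ≡ p × b ≡ x)
      only (j , s≤s j≤i , t , h) with j ℕ.≟ i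
      ... | no ne    = inj₁ (j , ℕ.≤∧≢⇒< j≤i ne , t , h)
      ... | yes refl = inj₂ (toℕ-injective (trans (sym t) (proj₁ at)) ,
                             toℕ-injective (trans (sym h) (proj₂ at)))
      -- An earlier arc (x , b) would have a head of higher level than the later (p , x).
      sink : ∀ {b} → ¬ Before tl hd i x b
      sink {b} (j , j<i , t , h) = ℕ.<⇒≱ (ascends (arc (ℕ.<-trans j<i i<m) (t , h)))
        (subst₂ _≤_ (cong d h) (cong d (proj₂ at)) (monotone (ℕ.<⇒≤ j<i) i<m))
      p≢x : p ≢ x
      p≢x refl = ℕ.<-irrefl refl p<x

    labelling-finish : ∀ {s f} → Labelling (Before tl hd m) s f → Labelling Arc s f
    labelling-finish = labelling-resp (λ (j , j<m , at) → arc j<m at)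
      (λ a → index-of a) (λ _ → refl)

  labelAll-correct : ∀ {d} σ → σ dims 0 ≡ n → σ dims 1 ≡ m → IsLevel G d →
    Sorted G d (σ sortedTails) (σ sortedHeads) → (∀ y → σ label y ≡ 0) →
    ∀ s → Labelling Arc s (row (run labelAll σ label) s)
  labelAll-correct {d} σ n≡ m≡ isLevel sorted zeros =
    λ s → done result (subst (toℕ s <_) (sym n≡) (toℕ<n s))
    where
    tl = σ sortedTails
    hd = σ sortedHeads
    -- The rows of the sources below i are final, the others still empty.
    record Sources (i : ℕ) (f : ℕ → ℕ) : Set where
      field
        done  : ∀ {s : Vertex} → toℕ s < i → Labelling Arc s (row f s)
        blank : ∀ {s : Vertex} → i ≤ toℕ s → ∀ (x : Vertex) → row f s x ≡ 0
    open Sources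
    -- The row of s is right for the first i arcs; the other rows are as in f₀.
    record Arcs (s : Vertex) (f₀ : ℕ → ℕ) (i : ℕ) (f : ℕ → ℕ) : Set where
      field
        current : Labelling (Before tl hd i) s (row f s)
        rest    : ∀ {s′ : Vertex} → s′ ≢ s → ∀ (x : Vertex) → row f s′ x ≡ row f₀ s′ x
    open Arcs

    step : ∀ υ {s i f₀} → i < m → υ dims 0 ≡ n → υ i₁ 0 ≡ toℕ s → υ i₂ 0 ≡ i →
      (∀ x → υ sortedTails x ≡ tl x) → (∀ x → υ sortedHeads x ≡ hd x) →
      Arcs s f₀ i (υ label) → Arcs s f₀ (suc i) (run relaxLabel υ label)
    step υ {s} i<m n≡ s≡ refl tl≡ hd≡ inv
      with Enumerates.arc-at (Sorted.enumerates sorted) _ i<m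
    ... | p , x , _ , t , h = record
      { current = labelling-step isLevel sorted i<m (t , h) S (current inv)
      ; rest    = λ s′≢s y → trans
          (Step.others S _ (λ e → s′≢s (proj₁ (index-injective {j = y} {x} e)))) (rest inv s′≢s y) }
      where S = relaxLabel-step υ n≡ s≡ (trans (tl≡ _) t) (trans (hd≡ _) h)

    source : ∀ τ {i} → i < n → τ dims 0 ≡ n → τ dims 1 ≡ m → τ i₁ 0 ≡ i →
      (∀ x → τ sortedTails x ≡ tl x) → (∀ x → τ sortedHeads x ≡ hd x) →
      Sources i (τ label) → Sources (suc i) (run labelFrom τ label)
    source τ {i} i<n n≡ m≡ i≡ tl≡ hd≡ inv = record { done = done′ ; blank = blank′ }
      where
      s : Vertex
      s = fromℕ< i<n
      s≡ : τ i₁ 0 ≡ toℕ s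
      s≡ = trans i≡ (sym (toℕ-fromℕ< i<n))
      τ₁ = run startLabel τ
      ix : eval τ (cell (reg i₁) (reg i₁)) ≡ index s s
      ix = eval-cell τ (reg i₁) (reg i₁) n≡ s≡ s≡
      others : ∀ y → y ≢ index s s → τ₁ label y ≡ τ label y
      others y y≢ = if-elim (_≡ τ label y) (eval τ (cell (reg i₁) (reg i₁))) y
        (λ e → ⊥-elim (y≢ (trans (sym e) ix))) (λ _ → refl)
      root : row (τ₁ label) s s ≡ suc (toℕ s)
      root = trans (cong (τ₁ label) (sym ix))
        (trans (update-same τ label _ _) (trans (cong (_+ 1) s≡) (ℕ.+-comm _ 1)))
      result : Arcs s (τ₁ label) m (run labelFrom τ label)
      result = subst (λ k → Arcs s (τ₁ label) k (run labelFrom τ label)) m≡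
        (loop-rule i₂ 1 relaxLabel τ₁ (λ k υ → Arcs s (τ₁ label) k (υ label)) refl
          (record
            { current = labelling-no-arcs (λ { (_ , () , _) }) root
                (λ x x≢s → trans (others _ (λ e → x≢s (proj₂ (index-injective {i = s} {s} e))))
                             (blank inv (ℕ.≤-reflexive (sym (toℕ-fromℕ< i<n))) x))
            ; rest = λ _ _ → refl })
          (λ k υ k< k≡ same → step υ (subst (k <_) m≡ k<) (trans (same dims 0 refl) n≡)
            (trans (same i₁ 0 refl) s≡) k≡
            (λ x → trans (same sortedTails x refl) (tl≡ x))
            (λ x → trans (same sortedHeads x refl) (hd≡ x))))
      unchanged : ∀ {s′ : Vertex} → s′ ≢ s → ∀ (x : Vertex) →
        row (run labelFrom τ label) s′ x ≡ row (τ label) s′ x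
      unchanged s′≢s x = trans (rest result s′≢s x)
        (others _ (λ e → s′≢s (proj₁ (index-injective {j = x} {s} e))))
      done′ : ∀ {s′ : Vertex} → toℕ s′ < suc i → Labelling Arc s′ (row (run labelFrom τ label) s′)
      done′ {s′} (s≤s s′≤i) with s′ ≟ s
      ... | yes refl = labelling-finish isLevel sorted (current result)
      ... | no s′≢s  = labelling-resp (λ a → a) (λ a → a) (λ x → sym (unchanged s′≢s x))
        (done inv (ℕ.≤∧≢⇒< s′≤i λ e → s′≢s (toℕ-injective (trans e (sym (toℕ-fromℕ< i<n))))))
      blank′ : ∀ {s′ : Vertex} → suc i ≤ toℕ s′ → ∀ (x : Vertex) →
        row (run labelFrom τ label) s′ x ≡ 0
      blank′ {s′} i<s′ x = trans
        (unchanged {s′} (λ { refl → ℕ.<-irrefl (sym (toℕ-fromℕ< i<n)) i<s′ }) x)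
        (blank inv {s′} (ℕ.<⇒≤ i<s′) x)

    result : Sources (σ dims 0) (run labelAll σ label)
    result = loop-rule i₁ 0 labelFrom σ (λ i τ → Sources i (τ label)) refl
      (record { done = λ () ; blank = λ _ x → zeros _ })
      (λ i τ i< i≡ same → source τ (subst (i <_) n≡ i<) (trans (same dims 0 refl) n≡)
        (trans (same dims 1 refl) m≡) i≡ (λ x → same sortedTails x refl) (λ x → same sortedHeads x refl))

-- Marking the lowest common ancestors

-- A value used as a condition: it is nonzero iff A holds.
record Tests (v : ℕ) (A : Set) : Set where
  constructor tests
  field
    reflects : v ≢ 0 → A
    refutes  : v ≡ 0 → ¬ A
open Tests

tests-nonzero : ∀ {v w} → v ≡ w → Tests v (w ≢ 0)
tests-nonzero refl = tests (λ ≢0 → ≢0) (λ ≡0 ≢0 → ≢0 ≡0)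

tests-× : ∀ {v w A B} → Tests v A → Tests w B → Tests (v * w) (A × B)
tests-× {v} {w} a b = tests
  (λ ≢0 → reflects a (λ { refl → ≢0 refl }) , reflects b (λ { refl → ≢0 (ℕ.*-zeroʳ v) }))
  (λ ≡0 (x , y) → [ (λ v≡0 → refutes a v≡0 x) , (λ w≡0 → refutes b w≡0 y) ]′
                    (ℕ.m*n≡0⇒m≡0∨n≡0 v ≡0))

tests-differ : ∀ τ e f {v w} → eval τ e ≡ v → eval τ f ≡ w → Tests (eval τ (differ e f)) (v ≢ w)
tests-differ τ e f refl refl = tests (differ-reflects τ e f) (λ ≡0 ne → ne (differ-refutes τ e f ≡0))

tests-map : ∀ {v A B} → (A → B) → (B → A) → Tests v A → Tests v B
tests-map f g t = tests (λ ≢0 → f (reflects t ≢0)) (λ ≡0 b → refutes t ≡0 (g b))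

decides-map : ∀ {b A B} → (A → B) → (B → A) → b Decides A → b Decides B
decides-map f g (inj₁ (e , a))  = inj₁ (e , f a)
decides-map f g (inj₂ (e , ¬a)) = inj₂ (e , λ b → ¬a (g b))

labelAt : Expr → Expr → Expr
labelAt s x = label [ cell s x ]

-- Nonzero iff the vertex given by the expression is a junction of pair number i₁.
separates : Expr → Expr
separates s = (u ⊗ v) ⊗ differ u v
  where
  u = labelAt s (firstOf [ reg i₁ ])
  v = labelAt s (secondOf [ reg i₁ ])

-- Nonzero iff i₃ is a junction of pair number i₁ that differs from i₂ and is
-- reachable from it.
lower : Expr
lower = (separates (reg i₃) ⊗ differ (reg i₂) (reg i₃)) ⊗ labelAt (reg i₂) (reg i₃)

initFlag exclude writeOutput markOne markAll : Prog
initFlag = test (separates (reg i₂)) (put flag (lit 0) 1) (put flag (lit 0) 0)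
exclude  = test lower (put flag (lit 0) 0) pass
writeOutput = copy output (cell (reg i₁) (reg i₂)) flag (lit 0) 0
markOne  = initFlag then loop i₃ 0 exclude then writeOutput
markAll  = loop i₁ 2 (loop i₂ 0 markOne)

module _ {n : ℕ} (f : ℕ → ℕ) (u v : Fin n) where

  -- In terms of the label matrix f: s is a junction of u and v.
  SeparatedAt : Fin n → Set
  SeparatedAt s = Separated (row f s u) (row f s v)

  -- s′ ≠ s is a junction of u and v reachable from s.
  Lower : Fin n → Fin n → Set
  Lower s s′ = (SeparatedAt s′ × toℕ s ≢ toℕ s′) × row f s s′ ≢ 0

  -- s is a junction of u and v, and none of the first i vertices shows that it is
  -- not lowest.
  Lowest : ℕ → Fin n → Set
  Lowest i s = SeparatedAt s × (∀ s′ → toℕ s′ < i → ¬ Lower s s′)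

  module _ (τ : Store) (n≡ : τ dims 0 ≡ n) (f≡ : ∀ y → τ label y ≡ f y)
    (u≡ : τ firstOf (τ i₁ 0) ≡ toℕ u) (v≡ : τ secondOf (τ i₁ 0) ≡ toℕ v) where

    eval-labelAt : ∀ e e′ {s x : Fin n} → eval τ e ≡ toℕ s → eval τ e′ ≡ toℕ x →
      eval τ (labelAt e e′) ≡ row f s x
    eval-labelAt e e′ s≡ x≡ = trans (cong (τ label) (eval-cell τ e e′ n≡ s≡ x≡)) (f≡ _)

    separates-tests : ∀ e {s} → eval τ e ≡ toℕ s → Tests (eval τ (separates e)) (SeparatedAt s)
    separates-tests e s≡ = tests-map (λ ((a , b) , c) → a , b , c) (λ (a , b , c) → (a , b) , c)
      (tests-× (tests-× (tests-nonzero at-u) (tests-nonzero at-v)) 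
        (tests-differ τ (labelAt e (firstOf [ reg i₁ ])) (labelAt e (secondOf [ reg i₁ ])) at-u at-v))
      where
      at-u = eval-labelAt e (firstOf [ reg i₁ ]) s≡ u≡
      at-v = eval-labelAt e (secondOf [ reg i₁ ]) s≡ v≡

    lower-tests : ∀ {s s′} → τ i₂ 0 ≡ toℕ s → τ i₃ 0 ≡ toℕ s′ → Tests (eval τ lower) (Lower s s′)
    lower-tests s≡ s′≡ =
      tests-× (tests-× (separates-tests (reg i₃) s′≡) (tests-differ τ (reg i₂) (reg i₃) s≡ s′≡))
        (tests-nonzero (eval-labelAt (reg i₂) (reg i₃) s≡ s′≡))

    initFlag-correct : ∀ {s} → τ i₂ 0 ≡ toℕ s → run initFlag τ flag 0 Decides Lowest 0 s
    initFlag-correct {s} s≡ =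
      test-elim (λ τ′ → τ′ flag 0 Decides Lowest 0 s) (separates (reg i₂))
        (put flag (lit 0) 1) (put flag (lit 0) 0) τ
        (λ ≢0 → inj₁ (refl , reflects t ≢0 , λ _ ()))
        (λ ≡0 → inj₂ (refl , λ (sep , _) → refutes t ≡0 sep))
      where t = separates-tests (reg i₂) s≡

    exclude-correct : ∀ {s s′} → τ i₂ 0 ≡ toℕ s → τ i₃ 0 ≡ toℕ s′ →
      τ flag 0 Decides Lowest (toℕ s′) s → run exclude τ flag 0 Decides Lowest (suc (toℕ s′)) s
    exclude-correct {s} {s′} s≡ s′≡ dec =
      test-elim (λ τ′ → τ′ flag 0 Decides Lowest (suc (toℕ s′)) s) lower
        (put flag (lit 0) 0) pass τ
        (λ ≢0 → inj₂ (refl , λ (_ , none) → none s′ ℕ.≤-refl (reflects t ≢0)))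
        (λ ≡0 → decides-map
          (λ (sep , none) → sep , λ s″ s″< → next none (refutes t ≡0) s″ s″<)
          (λ (sep , none) → sep , λ s″ s″< → none s″ (ℕ.m<n⇒m<1+n s″<)) dec)
      where
      t = lower-tests s≡ s′≡
      next : (∀ s″ → toℕ s″ < toℕ s′ → ¬ Lower s s″) → ¬ Lower s s′ →
             ∀ s″ → toℕ s″ < suc (toℕ s′) → ¬ Lower s s″
      next none ¬here s″ (s≤s s″≤) with s″ ≟ s′
      ... | yes refl = ¬here
      ... | no ne    = none s″ (ℕ.≤∧≢⇒< s″≤ λ e → ne (toℕ-injective e))

  markOne-flag : ∀ τ {s} → τ dims 0 ≡ n → (∀ y → τ label y ≡ f y) →
    τ firstOf (τ i₁ 0) ≡ toℕ u → τ secondOf (τ i₁ 0) ≡ toℕ v → τ i₂ 0 ≡ toℕ s →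
    run (loop i₃ 0 exclude) (run initFlag τ) flag 0 Decides Lowest n s
  markOne-flag τ {s} n≡ f≡ u≡ v≡ s≡ =
    subst (λ i → run (loop i₃ 0 exclude) (run initFlag τ) flag 0 Decides Lowest i s)
      (trans (same₀ dims 0 refl) n≡)
      (loop-rule i₃ 0 exclude (run initFlag τ) (λ i υ → υ flag 0 Decides Lowest i s) refl
        (initFlag-correct τ n≡ f≡ u≡ v≡ s≡)
        step)
    where
    same₀ : ∀ b x → writes initFlag b ≡ false → run initFlag τ b x ≡ τ b x
    same₀ b x e = frame initFlag e τ x
    step : ∀ i υ → i < run initFlag τ dims 0 → υ i₃ 0 ≡ i →
      (∀ b x → writes (loop i₃ 0 exclude) b ≡ false → υ b x ≡ run initFlag τ b x) →
      υ flag 0 Decides Lowest i s → run exclude υ flag 0 Decides Lowest (suc i) s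
    step i υ i< i≡ same dec =
      subst (λ j → run exclude υ flag 0 Decides Lowest (suc j) s) s′≡
        (exclude-correct υ (trans (keep dims 0 refl refl) n≡) (λ y → trans (keep label y refl refl) (f≡ y))
          (trans (cong (υ firstOf) (keep i₁ 0 refl refl)) (trans (keep firstOf _ refl refl) u≡))
          (trans (cong (υ secondOf) (keep i₁ 0 refl refl)) (trans (keep secondOf _ refl refl) v≡))
          (trans (keep i₂ 0 refl refl) s≡) (trans i≡ (sym s′≡))
          (subst (λ j → υ flag 0 Decides Lowest j s) (sym s′≡) dec))
      where
      i<n : i < n
      i<n = subst (i <_) (trans (same₀ dims 0 refl) n≡) i<
      s′≡ : toℕ (fromℕ< i<n) ≡ i
      s′≡ = toℕ-fromℕ< i<n
      keep : ∀ b x → writes (loop i₃ 0 exclude) b ≡ false → writes initFlag b ≡ false → υ b x ≡ τ b x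
      keep b x e e′ = trans (same b x e) (same₀ b x e′)

module _ {n k : ℕ} (u v : Fin k → Fin n) where

  -- The output is right for all pairs below j, and for pair j and the first i
  -- vertices.
  record Marked (f : ℕ → ℕ) (j i : ℕ) (out : ℕ → ℕ) : Set where
    field
      marked : ∀ (j′ : Fin k) (s : Fin n) → toℕ j′ < j ⊎ (toℕ j′ ≡ j × toℕ s < i) →
               row out j′ s Decides Lowest f (u j′) (v j′) n s
  open Marked

  markOne-correct : ∀ τ f {j : Fin k} {s : Fin n} → τ dims 0 ≡ n → (∀ y → τ label y ≡ f y) →
    (∀ j → τ firstOf (toℕ j) ≡ toℕ (u j)) → (∀ j → τ secondOf (toℕ j) ≡ toℕ (v j)) →
    τ i₁ 0 ≡ toℕ j → τ i₂ 0 ≡ toℕ s →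
    Marked f (toℕ j) (toℕ s) (τ output) → Marked f (toℕ j) (suc (toℕ s)) (run markOne τ output)
  markOne-correct τ f {j} {s} n≡ f≡ u≡ v≡ j≡ s≡ inv = record { marked = marked′ }
    where
    τ₂ = run (loop i₃ 0 exclude) (run initFlag τ)
    keep : ∀ b x → writes (loop i₃ 0 exclude) b ≡ false → writes initFlag b ≡ false → τ₂ b x ≡ τ b x
    keep b x e e′ = trans (frame (loop i₃ 0 exclude) e (run initFlag τ) x) (frame initFlag e′ τ x)
    address : eval τ₂ (cell (reg i₁) (reg i₂)) ≡ index j s
    address = eval-cell τ₂ (reg i₁) (reg i₂) (trans (keep dims 0 refl refl) n≡)
      (trans (keep i₁ 0 refl refl) j≡) (trans (keep i₂ 0 refl refl) s≡)
    new : row (run markOne τ output) j s ≡ τ₂ flag 0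
    new = trans (cong (run markOne τ output) (sym address))
      (trans (update-same τ₂ output _ _) (ℕ.+-identityʳ _))
    old : ∀ j′ s′ → index j′ s′ ≢ index j s → row (run markOne τ output) j′ s′ ≡ row (τ output) j′ s′
    old j′ s′ ne = trans
      (if-elim (_≡ τ₂ output (index j′ s′)) (eval τ₂ (cell (reg i₁) (reg i₂))) (index j′ s′)
        (λ e → ⊥-elim (ne (trans (sym e) address))) (λ _ → refl))
      (keep output _ refl refl)
    marked′ : ∀ j′ s′ → toℕ j′ < toℕ j ⊎ (toℕ j′ ≡ toℕ j × toℕ s′ < suc (toℕ s)) →
      row (run markOne τ output) j′ s′ Decides Lowest f (u j′) (v j′) n s′
    marked′ j′ s′ (inj₁ lt) = subst (_Decides Lowest f (u j′) (v j′) n s′)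
      (sym (old j′ s′ λ e → ℕ.<-irrefl (cong toℕ (proj₁ (index-injective {i = j′} {j} {s′} {s} e))) lt))
      (marked inv j′ s′ (inj₁ lt))
    marked′ j′ s′ (inj₂ (j′≡ , s≤s s′≤)) with s′ ≟ s | toℕ-injective j′≡
    ... | yes refl | refl = subst (_Decides Lowest f (u j) (v j) n s) (sym new)
      (markOne-flag f (u j) (v j) τ n≡ f≡ (trans (cong (τ firstOf) j≡) (u≡ j))
        (trans (cong (τ secondOf) j≡) (v≡ j)) s≡)
    ... | no ne    | refl = subst (_Decides Lowest f (u j) (v j) n s′)
      (sym (old j s′ λ e → ne (proj₂ (index-injective {i = j} {j} {s′} {s} e))))
      (marked inv j s′ (inj₂ (refl , ℕ.≤∧≢⇒< s′≤ λ e → ne (toℕ-injective e))))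

  markAll-correct : ∀ σ → σ dims 0 ≡ n → σ dims 2 ≡ k →
    (∀ j → σ firstOf (toℕ j) ≡ toℕ (u j)) → (∀ j → σ secondOf (toℕ j) ≡ toℕ (v j)) →
    ∀ j s → row (run markAll σ output) j s Decides Lowest (σ label) (u j) (v j) n s
  markAll-correct σ n≡ k≡ u≡ v≡ j s =
    marked result j s (inj₁ (subst (toℕ j <_) (sym k≡) (toℕ<n j)))
    where
    f = σ label
    inner : ∀ τ {j : Fin k} → τ i₁ 0 ≡ toℕ j →
      (∀ b x → writes markAll b ≡ false → τ b x ≡ σ b x) →
      Marked f (toℕ j) 0 (τ output) → Marked f (toℕ j) n (run (loop i₂ 0 markOne) τ output)
    inner τ {j} j≡ same inv =
      subst (λ i → Marked f (toℕ j) i (run (loop i₂ 0 markOne) τ output))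
        (trans (same dims 0 refl) n≡)
        (loop-rule i₂ 0 markOne τ (λ i υ → Marked f (toℕ j) i (υ output)) refl inv step)
      where
      step : ∀ i υ → i < τ dims 0 → υ i₂ 0 ≡ i →
        (∀ b x → writes (loop i₂ 0 markOne) b ≡ false → υ b x ≡ τ b x) →
        Marked f (toℕ j) i (υ output) → Marked f (toℕ j) (suc i) (run markOne υ output)
      step i υ i< i≡ same′ inv′ =
        subst (λ i → Marked f (toℕ j) (suc i) (run markOne υ output)) s≡
          (markOne-correct υ f (trans (keep dims 0 refl refl) n≡) (λ y → keep label y refl refl)
            (λ j → trans (keep firstOf _ refl refl) (u≡ j))
            (λ j → trans (keep secondOf _ refl refl) (v≡ j))
            (trans (same′ i₁ 0 refl) j≡) (trans i≡ (sym s≡))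
            (subst (λ i → Marked f (toℕ j) i (υ output)) (sym s≡) inv′))
        where
        i<n : i < n
        i<n = subst (i <_) (trans (same dims 0 refl) n≡) i<
        s≡ : toℕ (fromℕ< i<n) ≡ i
        s≡ = toℕ-fromℕ< i<n
        keep : ∀ b x → writes (loop i₂ 0 markOne) b ≡ false → writes markAll b ≡ false → υ b x ≡ σ b x
        keep b x e e′ = trans (same′ b x e) (same b x e′)

    next-pair : ∀ {j} → ∀ {out} → Marked f j n out → Marked f (suc j) 0 out
    next-pair {j} {out} inv = record { marked = marked′ }
      where
      marked′ : ∀ j′ s → toℕ j′ < suc j ⊎ (toℕ j′ ≡ suc j × toℕ s < 0) →
        row out j′ s Decides Lowest f (u j′) (v j′) n s
      marked′ j′ s (inj₁ (s≤s j′≤j)) with toℕ j′ ℕ.≟ j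
      ... | yes e = marked inv j′ s (inj₂ (e , toℕ<n s))
      ... | no ne = marked inv j′ s (inj₁ (ℕ.≤∧≢⇒< j′≤j ne))

    result : Marked f (σ dims 2) 0 (run markAll σ output)
    result = loop-rule i₁ 2 (loop i₂ 0 markOne) σ (λ j τ → Marked f j 0 (τ output)) refl
      (record { marked = λ { _ _ (inj₁ ()) ; _ _ (inj₂ (_ , ())) } })
      (λ j τ j< j≡ same inv →
        let j<k = subst (j <_) k≡ j<
            e   = toℕ-fromℕ< j<k
        in next-pair (subst (λ j → Marked f j n (run (loop i₂ 0 markOne) τ output)) e
             (inner τ (trans j≡ (sym e)) same
               (subst (λ j → Marked f j 0 (τ output)) (sym e) inv))))

-- Correctness of the whole program on its input

at-map : {A : Set} (g : A → ℕ) (xs : List A) (i : Fin (length xs)) →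
  at 0 (map g xs) (toℕ i) ≡ g (lookup xs i)
at-map g (x ∷ xs) Fin.zero    = refl
at-map g (x ∷ xs) (Fin.suc i) = at-map g xs i

at-bounded : ∀ {V xs} → All (_≤ V) xs → ∀ i → at 0 xs i ≤ V
at-bounded []         i       = z≤n
at-bounded (x≤ ∷ _)   zero    = x≤
at-bounded (_ ∷ xs≤)  (suc i) = at-bounded xs≤ i

load-bounded : ∀ {V xss} → All (All (_≤ V)) xss → Bounded V (load xss)
load-bounded []          a       i = z≤n
load-bounded (xs≤ ∷ _)   zero    i = at-bounded xs≤ i
load-bounded (_ ∷ xss≤)  (suc a) i = load-bounded xss≤ a i

load-enumerates : ∀ G → Enumerates G (at 0 (firsts (DAG.arcs G))) (at 0 (seconds (DAG.arcs G)))
load-enumerates G = record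
  { arc-at = λ e e<m →
      let i = fromℕ< e<m
          i≡ = toℕ-fromℕ< e<m
      in _ , _ , ∈-lookup i ,
         trans (cong (at 0 (firsts arcs)) (sym i≡)) (at-map _ arcs i) ,
         trans (cong (at 0 (seconds arcs)) (sym i≡)) (at-map _ arcs i)
  ; index-of = λ a →
      let i = Any.index a
          a≡ = sym (lookup-index a)
      in toℕ i , toℕ<n i ,
         trans (at-map _ arcs i) (cong (λ e → toℕ (proj₁ e)) a≡) ,
         trans (at-map _ arcs i) (cong (λ e → toℕ (proj₂ e)) a≡)
  }
  where open DAG G

lcaProg : Prog
lcaProg = findLevels then sortArcs then labelAll then markAll

module _ (I : LCAInstance) where
  open LCAInstance I

  input : Store
  input = load (Problem.encode allLCAs I)

  lowest⇔LCA : ∀ f → (∀ s → Labelling Arc s (row f s)) → ∀ {u v s b} →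
    b Decides Lowest f u v n s → b Decides IsLCA s u v
  lowest⇔LCA f L {u} {v} {s} = decides-map
    (λ (sep , none) → separated⇒junction graph (L s) sep ,
      λ s′ J s′≢s P → none s′ (toℕ<n s′)
        ((junction⇒separated graph (L s′) J , λ e → s′≢s (sym (toℕ-injective e))) ,
         Labelling.complete (L s) s′ P))
    (λ (J , none) → junction⇒separated graph (L s) J ,
      λ s′ _ ((sep , s≢s′) , reach) → none s′ (separated⇒junction graph (L s′) sep)
        (λ e → s≢s′ (cong toℕ (sym e))) (Labelling.sound (L s) s′ reach))

  lcaProg-correct : Problem.Correct allLCAs I (run lcaProg input)
  lcaProg-correct j s = lowest⇔LCA (σ₃ label) labels
    (markAll-correct (λ j → proj₁ (lookup pairs j)) (λ j → proj₂ (lookup pairs j)) σ₃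
      (keep₃ dims 0 refl refl refl) (keep₃ dims 2 refl refl refl)
      (λ j → trans (keep₃ firstOf _ refl refl refl) (at-map _ pairs j))
      (λ j → trans (keep₃ secondOf _ refl refl refl) (at-map _ pairs j)) j s)
    where
    σ₁ = run findLevels input
    σ₂ = run sortArcs σ₁
    σ₃ = run labelAll σ₂
    keep₁ : ∀ b x → writes findLevels b ≡ false → σ₁ b x ≡ input b x
    keep₁ b x e = frame findLevels e input x
    keep₂ : ∀ b x → writes findLevels b ≡ false → writes sortArcs b ≡ false → σ₂ b x ≡ input b x
    keep₂ b x e e′ = trans (frame sortArcs e′ σ₁ x) (keep₁ b x e)
    keep₃ : ∀ b x → writes findLevels b ≡ false → writes sortArcs b ≡ false →
      writes labelAll b ≡ false → σ₃ b x ≡ input b x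
    keep₃ b x e e′ e″ = trans (frame labelAll e″ σ₂ x) (keep₂ b x e e′)
    levels : IsLevel graph (σ₁ level)
    levels = findLevels-correct graph input refl refl (load-enumerates graph) (λ _ → refl)
    enum₁ : Enumerates graph (σ₁ tails) (σ₁ heads)
    enum₁ = record
      { arc-at   = λ e e<m → let u , v , a , t , h = arc-at e e<m in
          u , v , a , trans (keep₁ tails e refl) t , trans (keep₁ heads e refl) h
      ; index-of = λ a → let e , e<m , t , h = index-of a in
          e , e<m , trans (keep₁ tails e refl) t , trans (keep₁ heads e refl) h }
      where open Enumerates (load-enumerates graph)
    sorted : Sorted graph (σ₁ level) (σ₂ sortedTails) (σ₂ sortedHeads)
    sorted = sortArcs-correct graph σ₁ (keep₁ dims 0 refl) (keep₁ dims 1 refl) enum₁ levels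
               (keep₁ filled 0 refl)
    labels : ∀ s → Labelling Arc s (row (σ₃ label) s)
    labels = labelAll-correct graph σ₂ (keep₂ dims 0 refl refl) (keep₂ dims 1 refl refl)
               levels sorted (λ y → keep₂ label y refl refl)

  input-bounded : Bounded (n + m + k) input
  input-bounded = load-bounded
    ((≤n ℕ.≤-refl ∷ ℕ.≤-trans (ℕ.m≤n+m m n) (ℕ.m≤m+n (n + m) k) ∷ ℕ.m≤n+m k (n + m) ∷ [])
     ∷ vertices-≤ _ arcs ∷ vertices-≤ _ arcs ∷ vertices-≤ _ pairs ∷ vertices-≤ _ pairs ∷ [])
    where
    ≤n : ∀ {x} → x ≤ n → x ≤ n + m + k
    ≤n x≤ = ℕ.≤-trans x≤ (ℕ.≤-trans (ℕ.m≤m+n n m) (ℕ.m≤m+n (n + m) k))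
    vertices-≤ : {A : Set} (g : A → Vertex) (xs : List A) → All (_≤ n + m + k) (map (λ x → toℕ (g x)) xs)
    vertices-≤ g xs = map⁺ (All.universal (λ x → ≤n (ℕ.<⇒≤ (toℕ<n (g x)))) xs)

-- Factor for a loop around a second loop with body of cost c, preceded by
-- commands of cost a.
nested-K : ℕ → ℕ → ℕ
nested-K a c = 9 + (21 + a) + (12 + c)

-- Factor for two nested loops around a third loop with body of cost c, which has
-- commands of cost a before and b after it.
triple-K : ℕ → ℕ → ℕ → ℕ
triple-K a b c = 9 + 21 + (21 + a + b) + (12 + c)

nested-bound : ∀ N M a c {P} → 1 ≤ P → N ≤ P → N * M ≤ P →
  9 + N * (12 + (a + (9 + M * (12 + c)))) ≤ nested-K a c * P
nested-bound N M a c {P} 1≤ N≤ NM≤ = ℕ.≤-trans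
  (ℕ.≤-reflexive (solve 4 (λ N M a c →
    con 9 :+ N :* (con 12 :+ (a :+ (con 9 :+ M :* (con 12 :+ c)))) :=
    con 9 :* con 1 :+ (con 21 :+ a) :* N :+ (con 12 :+ c) :* (N :* M)) refl N M a c))
  (ℕ.≤-trans
    (ℕ.+-mono-≤ (ℕ.+-mono-≤ (ℕ.*-monoʳ-≤ 9 1≤) (ℕ.*-monoʳ-≤ (21 + a) N≤)) (ℕ.*-monoʳ-≤ (12 + c) NM≤))
    (ℕ.≤-reflexive (solve 3 (λ P a c →
      con 9 :* P :+ (con 21 :+ a) :* P :+ (con 12 :+ c) :* P :=
      (con 9 :+ (con 21 :+ a) :+ (con 12 :+ c)) :* P) refl P a c)))
  where open +-*-Solver

triple-bound : ∀ K N a b c {P} → 1 ≤ P → K ≤ P → N * K ≤ P → N * N * K ≤ P →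
  9 + K * (12 + (9 + N * (12 + (a + ((9 + N * (12 + c)) + b))))) ≤
  triple-K a b c * P
triple-bound K N a b c {P} 1≤ K≤ NK≤ NNK≤ = ℕ.≤-trans
  (ℕ.≤-reflexive (solve 5 (λ K N a b c →
    con 9 :+ K :* (con 12 :+ (con 9 :+ N :* (con 12 :+ (a :+ ((con 9 :+ N :* (con 12 :+ c)) :+ b))))) :=
    con 9 :* con 1 :+ con 21 :* K :+ (con 21 :+ a :+ b) :* (N :* K) :+ (con 12 :+ c) :* (N :* N :* K))
    refl K N a b c))
  (ℕ.≤-trans
    (ℕ.+-mono-≤ (ℕ.+-mono-≤ (ℕ.+-mono-≤ (ℕ.*-monoʳ-≤ 9 1≤) (ℕ.*-monoʳ-≤ 21 K≤))
      (ℕ.*-monoʳ-≤ (21 + a + b) NK≤)) (ℕ.*-monoʳ-≤ (12 + c) NNK≤))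
    (ℕ.≤-reflexive (solve 4 (λ P a b c →
      con 9 :* P :+ con 21 :* P :+ (con 21 :+ a :+ b) :* P :+ (con 12 :+ c) :* P :=
      (con 9 :+ con 21 :+ (con 21 :+ a :+ b) :+ (con 12 :+ c)) :* P) refl P a b c)))
  where open +-*-Solver

-- The bound for a program without loops, for which the limits are irrelevant.
flat : Prog → ℕ
flat = bound (λ _ → 0)

budget : (n m k : ℕ) → ℕ
budget n m k = n * (m + k) + n * n * k

module _ {n m k : ℕ} (1≤n : 1 ≤ n) (1≤k : 1 ≤ k) where

  private
    P = budget n m k

  nm≤budget : n * m ≤ P
  nm≤budget = ℕ.≤-trans (ℕ.*-monoʳ-≤ n (ℕ.m≤m+n m k)) (ℕ.m≤m+n (n * (m + k)) (n * n * k))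

  nk≤budget : n * k ≤ P
  nk≤budget = ℕ.≤-trans (ℕ.*-monoʳ-≤ n (ℕ.m≤n+m k m)) (ℕ.m≤m+n (n * (m + k)) (n * n * k))

  nnk≤budget : n * n * k ≤ P
  nnk≤budget = ℕ.m≤n+m (n * n * k) (n * (m + k))

  n≤budget : n ≤ P
  n≤budget = ℕ.≤-trans (ℕ.m≤m*n n k {{>-nonZero 1≤k}}) nk≤budget

  k≤budget : k ≤ P
  k≤budget = ℕ.≤-trans (ℕ.m≤n*m k n {{>-nonZero 1≤n}}) nk≤budget

  1≤budget : 1 ≤ P
  1≤budget = ℕ.≤-trans 1≤n n≤budget

sum-bound : ∀ A B C D {a b c d} P → a ≤ A * P → b ≤ B * P → c ≤ C * P → d ≤ D * P →
  a + (b + (c + d)) ≤ (A + (B + (C + D))) * P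
sum-bound A B C D P a≤ b≤ c≤ d≤ = ℕ.≤-trans
  (ℕ.+-mono-≤ a≤ (ℕ.+-mono-≤ b≤ (ℕ.+-mono-≤ c≤ d≤)))
  (ℕ.≤-reflexive (solve 5 (λ A B C D P → A :* P :+ (B :* P :+ (C :* P :+ D :* P)) :=
                                         (A :+ (B :+ (C :+ D))) :* P) refl A B C D P))
  where open +-*-Solver

lcaProg-K : ℕ
lcaProg-K = nested-K 0 (flat raise) + (nested-K 0 (flat appendIfLevel) +
  (nested-K (flat startLabel) (flat relaxLabel) +
   triple-K (flat initFlag) (flat writeOutput) (flat exclude)))

lcaProg-bound : ∀ N → 1 ≤ N 0 → 1 ≤ N 2 →
  bound N lcaProg ≤ lcaProg-K * budget (N 0) (N 1) (N 2)
lcaProg-bound N 1≤n 1≤k =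
  sum-bound (nested-K 0 (flat raise)) (nested-K 0 (flat appendIfLevel))
    (nested-K (flat startLabel) (flat relaxLabel))
    (triple-K (flat initFlag) (flat writeOutput) (flat exclude)) P
    (nested 0 (flat raise)) (nested 0 (flat appendIfLevel))
    (nested (flat startLabel) (flat relaxLabel))
    (triple-bound (N 2) (N 0) (flat initFlag) (flat writeOutput) (flat exclude) {P}
      1≤P (k≤budget {m = N 1} 1≤n 1≤k) (nk≤budget {m = N 1} 1≤n 1≤k) (nnk≤budget {m = N 1} 1≤n 1≤k))
  where
  P = budget (N 0) (N 1) (N 2)
  1≤P : 1 ≤ P
  1≤P = 1≤budget {m = N 1} 1≤n 1≤k
  nested : ∀ a c → 9 + N 0 * (12 + (a + (9 + N 1 * (12 + c)))) ≤ nested-K a c * P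
  nested a c = nested-bound (N 0) (N 1) a c {P} 1≤P
    (n≤budget {m = N 1} 1≤n 1≤k) (nm≤budget {m = N 1} 1≤n 1≤k)

n≤2^n : ∀ n → n ≤ 2 ^ n
n≤2^n zero    = z≤n
n≤2^n (suc n) = ℕ.≤-trans (ℕ.+-mono-≤ (ℕ.m^n>0 2 n) (n≤2^n n))
  (ℕ.≤-reflexive (cong (λ z → 2 ^ n + z) (sym (ℕ.+-identityʳ (2 ^ n)))))

-- Time and values are bounded by a fixed power of the size; the crude K ≤ 2 ^ K
-- is good enough for the exponent.
polynomial : ∀ K {n m k b} → 2 ≤ b → n + m + k ≤ b → n + m + k + K * budget n m k ≤ b ^ suc (K + 4)
polynomial K {n} {m} {k} {b} 2≤b size≤b = begin
  n + m + k + K * budget n m k  ≤⟨ ℕ.+-mono-≤ size≤ (ℕ.*-mono-≤ (ℕ.≤-trans (n≤2^n K) (ℕ.^-monoˡ-≤ K 2≤b)) budget≤) ⟩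
  X + b ^ K * b ^ 4             ≡⟨ cong (λ z → X + z) (sym (ℕ.^-distribˡ-+-* b K 4)) ⟩
  X + X                         ≡⟨ cong (λ z → X + z) (sym (ℕ.+-identityʳ X)) ⟩
  2 * X                         ≤⟨ ℕ.*-monoˡ-≤ X 2≤b ⟩
  b * X                         ∎
  where
  open ℕ.≤-Reasoning
  open +-*-Solver
  X = b ^ (K + 4)
  instance
    b-nonZero : NonZero b
    b-nonZero = >-nonZero (ℕ.≤-trans (s≤s z≤n) 2≤b)
  n≤b : n ≤ b
  n≤b = ℕ.≤-trans (ℕ.≤-trans (ℕ.m≤m+n n m) (ℕ.m≤m+n (n + m) k)) size≤b
  k≤b : k ≤ b
  k≤b = ℕ.≤-trans (ℕ.m≤n+m k (n + m)) size≤b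
  mk≤b : m + k ≤ b
  mk≤b = ℕ.≤-trans (ℕ.+-monoˡ-≤ k (ℕ.m≤n+m m n)) size≤b
  budget≤ : budget n m k ≤ b ^ 4
  budget≤ = begin
    n * (m + k) + n * n * k  ≤⟨ ℕ.+-mono-≤ (ℕ.*-mono-≤ n≤b mk≤b) (ℕ.*-mono-≤ (ℕ.*-mono-≤ n≤b n≤b) k≤b) ⟩
    b * b + b * b * b        ≤⟨ ℕ.+-monoˡ-≤ (b * b * b) (ℕ.m≤m*n (b * b) b) ⟩
    b * b * b + b * b * b    ≡⟨ solve 1 (λ b → b :* b :* b :+ b :* b :* b := con 2 :* (b :* b :* b)) refl b ⟩
    2 * (b * b * b)          ≤⟨ ℕ.*-monoˡ-≤ (b * b * b) 2≤b ⟩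
    b * (b * b * b)          ≡⟨ solve 1 (λ b → b :* (b :* b :* b) := b :^ 4) refl b ⟩
    b ^ 4                    ∎
  size≤ : n + m + k ≤ X
  size≤ = ℕ.≤-trans size≤b (subst (λ e → b ≤ b ^ e) (sym (ℕ.+-suc K 3))
            (ℕ.m≤m*n b (b ^ (K + 3)) {{ℕ.m^n≢0 b (K + 3)}}))

-- A bound t ≤ C (1 + y) suffices for every exponent ω, as n ^ ω ≥ 1.
within : ∀ t C n y ω → 1 ≤ n → t ≤ C + C * y → t ≤ C ·[ n ^ ω + y ]
within t C n y ω 1≤n t≤ p q _ = ℕ.≤-trans
  (ℕ.^-monoˡ-≤ q (ℕ.≤-trans (ℕ.∸-monoˡ-≤ (C * y) t≤) (ℕ.≤-reflexive (ℕ.m+n∸n≡m C (C * y)))))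
  (ℕ.m≤m*n (C ^ q) (n ^ p) {{ℕ.m^n≢0 n p {{>-nonZero 1≤n}}}})

-- Without pairs only n ^ ω steps are granted, which the nm steps spent on the
-- labels may exceed.
lcaCmd : Cmd
lcaCmd = ifte (dims [ lit 2 ]) (compile lcaProg) skip

-- The time bound of `lcaProg` with an arbitrary factor K, kept symbolic.
solvable : ∀ ω K → (∀ N → 1 ≤ N 0 → 1 ≤ N 2 → bound N lcaProg ≤ K * budget (N 0) (N 1) (N 2)) →
  SolvableInO allLCAs LCAInstance.n ω
    (λ I → let open LCAInstance I in n * (m + k) + n * n * k)
solvable ω K bound≤ = lcaCmd , 4 + K , suc (K + 4) , solve
  where
  solve : ∀ I → let open LCAInstance I in ∃[ σ ] ∃[ t ]
    (((2 + (n + m + k)) ^ suc (K + 4)) ⊢ lcaCmd , load (Problem.encode allLCAs I) ⇓ σ , t) ×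
    Problem.Correct allLCAs I σ ×
    (1 ≤ n → t ≤ (4 + K) ·[ n ^ ω + (n * (m + k) + n * n * k) ])
  solve I with LCAInstance.k I ℕ.≟ 0
  ... | yes k≡0 =
    input I , 4 , if-false k≡0 skip ,
    (λ j → ⊥-elim (ℕ.n≮0 (subst (toℕ j <_) k≡0 (toℕ<n j)))) ,
    λ 1≤n → within 4 (4 + K) (LCAInstance.n I) (budget (LCAInstance.n I) (LCAInstance.m I) (LCAInstance.k I)) ω 1≤n
      (ℕ.≤-trans (ℕ.m≤m+n 4 K) (ℕ.m≤m+n (4 + K) _))
  ... | no k≢0 =
    run lcaProg (input I) , 3 + Runs.time execution ,
    if-true k≢0 (Runs.exec execution) , lcaProg-correct I ,
    λ 1≤n → within (3 + Runs.time execution) (4 + K) n (budget n m k) ω 1≤n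
      (ℕ.+-mono-≤ {3} {4 + K} (ℕ.≤-trans (ℕ.n≤1+n 3) (ℕ.m≤m+n 4 K))
      (ℕ.≤-trans (Runs.in-time execution) (ℕ.≤-trans bounded (ℕ.*-monoˡ-≤ (budget n m k) (ℕ.m≤n+m K 4)))))
    where
    open LCAInstance I
    1≤k : 1 ≤ k
    1≤k = ℕ.n≢0⇒n>0 k≢0
    1≤n : 1 ≤ n
    1≤n = ℕ.≤-trans (s≤s z≤n) (toℕ<n (proj₁ (lookup pairs (fromℕ< 1≤k))))
    bounded : bound (input I 0) lcaProg ≤ K * budget n m k
    bounded = bound≤ (input I 0) 1≤n 1≤k
    execution : Runs ((2 + (n + m + k)) ^ suc (K + 4)) (n + m + k) (bound (input I 0) lcaProg)
                  (compile lcaProg) (input I) (run lcaProg (input I))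
    execution = adequate (input I 0) _ lcaProg (n + m + k) (input I) refl refl (λ _ → refl)
      (input-bounded I)
      (ℕ.≤-trans (ℕ.+-monoʳ-≤ (n + m + k) bounded)
        (polynomial K {n} {m} {k} (ℕ.m≤m+n 2 (n + m + k)) (ℕ.m≤n+m (n + m + k) 2)))

mainTheorem3 : (ω : ℝ) → ω <ʳ (+ 2376 / 1000) →
    SolvableInO transitiveClosure DAG.n ω (λ _ → 0) →
    SolvableInO allLCAs LCAInstance.n ω
    (λ I → let open LCAInstance I in n * (m + k) + n * n * k)
mainTheorem3 ω _ _ = solvable ω lcaProg-K lcaProg-bound
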